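{- If $F$ is a random continuous function, then the measure $\lambda\circ F^{ -1}$ induced by $F$ is not a random measure.
   Context: $\lambda$ is the uniform (Lebesgue) measure on $2^\omega$; random continuous functions are total, so $\lambda\circ F^{ -1}$ is a Borel probability measure on $2^\omega$. Martin-Löf randomness of $x\in n^\omega$ is with respect to the uniform measure $\lambda_n$: $x$ is Martin-Löf random if $x\notin\bigcap_iU_i$ for every uniformly $\Sigma^0_1$ sequence $(U_i)$ of open subsets of $n^\omega$ with $\lambda_n(U_i)\le2^{ -i}$. Random continuous functions: let $\sigma_0=\epsilon,\sigma_1=0,\sigma_2=1,\dots$ be the length-lexicographic enumeration of $2^{<\omega}$. For $x\in3^\omega$ label node $\sigma_i$ ($i\ge1$) by $\ell_x(\sigma_i)=x(i-1)$, and let $F_x(y)$ be the sequence obtained from $\ell_x(y\restriction1),\ell_x(y\restriction2),\dots$ by deleting all $2$'s (undefined if only finitely many entries remain). $F$ is a random continuous function if $F=F_x$ for some Martin-Löf random $x\in3^\omega$. Random measures: fix a computable bijection $\langle\cdot,\cdot\rangle:\omega^2\to\omega$. For $x\in2^\omega$ let its $n$-th column $x_n\in2^\omega$ be $x_n(k)=x(\langle n,k\rangle)$, identified with the real $\sum_kx_n(k)2^{ -(k+1)}\in[0,1]$. Then $\mu_x$ is the unique Borel probability measure on $2^\omega$ with $\mu_x(\llbracket\sigma_n0\rrbracket)=x_n\cdot\mu_x(\llbracket\sigma_n\rrbracket)$ for all $n$. A measure $\mu$ is a random measure if $\mu=\mu_x$ for some Martin-Löf random $x\in2^\omega$. -}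

module Defs where

open import Data.Nat using (ℕ; suc; pred; _+_; _*_; _^_; _≤_; _<_; NonZero)
open import Data.Nat.Properties using (m^n≢0)
open import Data.Fin using (Fin; toℕ)
open import Data.Fin.Patterns using (0F; 1F; 2F)
open import Data.Integer using (+_)
open import Data.Rational as ℚ using (ℚ; 0ℚ; 1ℚ)
open import Data.Vec using (Vec; []; _∷_; lookup)
open import Data.Vec.Relation.Binary.Pointwise.Inductive using (Pointwise)
open import Data.List using (List; []; _∷_; _∷ʳ_; length; map; foldl; foldr; applyUpTo; mapMaybe)
open import Data.List.Relation.Unary.All using (All)
open import Data.List.Relation.Unary.AllPairs using (AllPairs)
open import Data.List.Relation.Binary.Prefix.Heterogeneous using (Prefix)
open import Data.Maybe using (Maybe; just; nothing)
open import Data.Product using (∃; ∃-syntax; _×_; _,_)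
open import Data.Sum using (_⊎_)
open import Function using (Bijective)
open import Level using (0ℓ)
open import Relation.Binary.PropositionalEquality using (_≡_)
open import Relation.Nullary using (¬_)
open import Relation.Unary using (Pred; _∈_; _⊆_; _≐_)

data Rec : ℕ → Set where
  zer  : ∀ {n} → Rec n
  succ : Rec 1
  proj : ∀ {n} → Fin n → Rec n
  comp : ∀ {m n} → Rec m → Vec (Rec n) m → Rec n
  prec : ∀ {n} → Rec n → Rec (2 + n) → Rec (1 + n)
  mu   : ∀ {n} → Rec (1 + n) → Rec n

-- e [ as ]⇓ v : the computation of e on the inputs as halts with value v.
data _[_]⇓_ : ∀ {n} → Rec n → Vec ℕ n → ℕ → Set where
  zer⇓  : ∀ {n} {as : Vec ℕ n} → zer [ as ]⇓ 0
  succ⇓ : ∀ {a} → succ [ a ∷ [] ]⇓ suc a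
  proj⇓ : ∀ {n} {as : Vec ℕ n} (i : Fin n) → proj i [ as ]⇓ lookup as i
  comp⇓ : ∀ {m n} {f : Rec m} {gs : Vec (Rec n) m} {as bs v} →
          Pointwise (λ g b → g [ as ]⇓ b) gs bs → f [ bs ]⇓ v →
          comp f gs [ as ]⇓ v
  prec0 : ∀ {n} {f : Rec n} {g : Rec (2 + n)} {as v} →
          f [ as ]⇓ v → prec f g [ 0 ∷ as ]⇓ v
  precS : ∀ {n} {f : Rec n} {g : Rec (2 + n)} {as k u v} →
          prec f g [ k ∷ as ]⇓ u → g [ k ∷ u ∷ as ]⇓ v →
          prec f g [ suc k ∷ as ]⇓ v
  mu⇓   : ∀ {n} {f : Rec (1 + n)} {as k} →
          f [ k ∷ as ]⇓ 0 →
          (∀ j → j < k → ∃[ v ] f [ j ∷ as ]⇓ suc v) →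
          mu f [ as ]⇓ k

_[_]↓ : ∀ {n} → Rec n → Vec ℕ n → Set
e [ as ]↓ = ∃[ v ] e [ as ]⇓ v

record ComputablePairing : Set where
  field
    ⟨_⟩        : ℕ × ℕ → ℕ
    bijective  : Bijective _≡_ _≡_ ⟨_⟩
    computable : ∃[ e ] ∀ a b → e [ a ∷ b ∷ [] ]⇓ ⟨ a , b ⟩

Str : ℕ → Set
Str n = List (Fin n)

Seq : ℕ → Set
Seq n = ℕ → Fin n

_↾_ : ∀ {n} → Seq n → ℕ → Str n
x ↾ k = applyUpTo x k

_≼_ : ∀ {n} → Str n → Str n → Set
_≼_ = Prefix _≡_

⟦_⟧ : ∀ {n} → Str n → Pred (Seq n) 0ℓ
⟦ σ ⟧ x = x ↾ length σ ≡ σ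

-- The position of a string in the length-lexicographic enumeration, i.e.
-- index σᵢ = i.  Appending a letter a to σ sends the index c to n·c + a + 1.
index : ∀ {n} → Str n → ℕ
index {n} = foldl (λ c a → n * c + suc (toℕ a)) 0

-- A real number a is represented by its lower cut {q ∈ ℚ | q < a}.  The
-- measure of an open set is a supremum of rationals, so its lower cut is
-- directly available.  With this encoding _⊆_ is ≤ and _≐_ is equality.

Real : Set₁
Real = Pred ℚ 0ℓ

rat : ℚ → Real
rat p q = q ℚ.< p

_+ᴿ_ : Real → Real → Real
(a +ᴿ b) q = ∃[ r ] ∃[ s ] r ∈ a × s ∈ b × q ℚ.< r ℚ.+ s

-- Product of two non-negative reals.  The first disjunct is needed when a
-- factor is 0, whose cut contains no non-negative rational.
_*ᴿ_ : Real → Real → Real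
(a *ᴿ b) q = q ℚ.< 0ℚ ⊎
  (∃[ r ] ∃[ s ] r ∈ a × s ∈ b × 0ℚ ℚ.≤ r × 0ℚ ℚ.≤ s × q ℚ.< r ℚ.* s)

sumℚ : List ℚ → ℚ
sumℚ = foldr ℚ._+_ 0ℚ

1/_^_ : (n k : ℕ) .{{_ : NonZero n}} → ℚ
1/ n ^ k = ℚ._/_ (+ 1) (n ^ k) {{m^n≢0 n k}}

-- The real Σₖ x(k) 2^{-(k+1)}, as the supremum of its partial sums.
binary : Seq 2 → Real
binary x q = ∃[ k ] q ℚ.<
  sumℚ (applyUpTo (λ j → ℚ._/_ (+ toℕ (x j)) 1 ℚ.* (1/ 2 ^ suc j)) k)

Antichain : ∀ {n} → List (Str n) → Set
Antichain = AllPairs (λ σ τ → ¬ (σ ≼ τ) × ¬ (τ ≼ σ))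

-- The uniform measure λₙ of an open subset of n^ω is the supremum of the measures of its clopen
-- subsets, and a clopen set is a finite disjoint union of cylinders.
measure : ∀ {n} .{{_ : NonZero n}} → Pred (Seq n) 0ℓ → Real
measure {n} U q = ∃[ A ]
  Antichain A ×
  All (λ σ → ⟦ σ ⟧ ⊆ U) A ×
  q ℚ.< sumℚ (map (λ σ → 1/ n ^ length σ) A)

-- The uniformly Σ⁰₁ sequence of open sets given by e: the i-th member is the
-- union of the cylinders ⟦σ⟧ with (i , σ) in the c.e. set dom(e).
Σ⁰₁ : ∀ {n} → Rec 2 → ℕ → Pred (Seq n) 0ℓ
Σ⁰₁ e i x = ∃[ σ ] x ∈ ⟦ σ ⟧ × e [ i ∷ index σ ∷ [] ]↓

MLRandom : ∀ {n} .{{_ : NonZero n}} → Seq n → Set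
MLRandom {n} x = (e : Rec 2) →
  (∀ i → measure {n} (Σ⁰₁ e i) ⊆ rat (1/ 2 ^ i)) →
  ¬ (∀ i → x ∈ Σ⁰₁ e i)

-- A partial function F on 2^ω is given by the relation
-- "F(y) is defined and F(y) ∈ ⟦σ⟧" between y and σ.
PartialMap : Set₁
PartialMap = Seq 2 → Pred (Str 2) 0ℓ

_⁻¹⟦_⟧ : PartialMap → Str 2 → Pred (Seq 2) 0ℓ
(F ⁻¹⟦ σ ⟧) y = σ ∈ F y

-- Meaningful for nonempty strings only: the root carries no label.
label : Seq 3 → Str 2 → Fin 3
label x σ = x (pred (index σ))

bit : Fin 3 → Maybe (Fin 2)
bit 0F = just 0F
bit 1F = just 1F
bit 2F = nothing

labels : Seq 3 → Seq 2 → Seq 3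
labels x y k = label x (y ↾ suc k)

-- F_x(y) is defined iff it is not the case that all but finitely many of the
-- labels along y are 2; it then extends σ iff σ is an initial segment of what
-- remains of some finite part of the labels after deleting the 2's.
function : Seq 3 → PartialMap
function x y σ =
  ¬ (∃[ m ] ∀ k → m ≤ k → labels x y k ≡ 2F) ×
  (∃[ m ] σ ≼ mapMaybe bit (labels x y ↾ m))

RandomContinuousFunction : PartialMap → Set
RandomContinuousFunction F =
  ∃[ x ] MLRandom x × (∀ y → F y ≐ function x y)

-- A Borel probability measure on 2^ω is identified with its values on
-- cylinders, which determine it.
CylinderMap : Set₁
CylinderMap = Str 2 → Real

record IsProbabilityMeasure (μ : CylinderMap) : Set where
  field
    total    : μ [] ≐ rat 1ℚ
    additive : ∀ σ → μ σ ≐ (μ (σ ∷ʳ 0F) +ᴿ μ (σ ∷ʳ 1F))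

-- The image measure λ ∘ F⁻¹.  When F is total and continuous the sets F⁻¹⟦σ⟧
-- are open, so `measure` gives their uniform measure.
induced : PartialMap → CylinderMap
induced F σ = measure (F ⁻¹⟦ σ ⟧)

module _ (P : ComputablePairing) where
  open ComputablePairing P

  column : Seq 2 → ℕ → Seq 2
  column x n k = x ⟨ n , k ⟩

  -- μ = μ_x.  The value on ⟦σ1⟧ is then forced by additivity.
  IsMeasureOf : Seq 2 → CylinderMap → Set
  IsMeasureOf x μ = IsProbabilityMeasure μ ×
    (∀ σ → μ (σ ∷ʳ 0F) ≐ (binary (column x (index σ)) *ᴿ μ σ))

  RandomMeasure : CylinderMap → Set
  RandomMeasure μ = ∃[ x ] MLRandom x × IsMeasureOf x μ

{-# OPTIONS --safe #-}

-- For random x the tree of nodes all of whose labels so far are 2 is finite: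
-- each path of length k survives with probability 3^-k, and there are only 2^k
-- of them.  If it has depth less than m, then the first bit of F(y) depends on
-- y ↾ m only, so the induced measure of ⟦0⟧ is a multiple of 2^-m.  In a random
-- measure it is the real coded by a column of a random sequence, whose digits
-- are not eventually constant.
--
-- Constructively, the random x is refuted by showing that every member of its
-- test contains x.  As membership is decidable, this may be proved by
-- contradiction, and non-membership at one level yields dyadicity, hence that
-- every member of the second test contains z.

module Submission where

open import Defs
open import Algebra.Bundles using (CommutativeMonoid)
open import Data.Fin.Base as Fin using (Fin; toℕ)
open import Data.Fin.Patterns
open import Data.Fin.Properties using (toℕ<n; toℕ≤pred[n]; toℕ-injective) renaming (_≟_ to _≟ᶠ_)
open import Data.Integer.Base as ℤ using (+_)
import Data.Integer.Properties as ℤ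
open import Data.List.Base as List using (List; []; _∷_; _∷ʳ_; map; head; length; applyUpTo; mapMaybe; foldl)
open import Data.List.Properties using (foldl-∷ʳ; applyUpTo-∷ʳ; length-applyUpTo)
open import Data.List.Relation.Binary.Prefix.Heterogeneous using (Prefix; []; _∷_)
open import Data.List.Relation.Unary.All as All using (All; []; _∷_)
open import Data.List.Relation.Unary.AllPairs using (AllPairs; []; _∷_)
open import Data.Maybe.Base using (Maybe; just; nothing)
open import Data.Nat
open import Data.Nat.Divisibility using (n∣m*n)
open import Data.Nat.DivMod using (m/n*n≤m; m*n/n≡m; +-distrib-/-∣ˡ; m<n⇒m/n≡0; m/n≤m; m≡m%n+[m/n]*n; m%n<n)
open import Data.Nat.GeneralisedArithmetic using (fold; fold-+)
open import Data.Nat.ListAction using (sum)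
open import Data.Nat.Properties
open import Data.Nat.Solver using (module +-*-Solver)
open import Data.Product using (∃-syntax; _×_; _,_; proj₁; proj₂)
open import Data.Rational.Base as ℚ using (ℚ; 0ℚ; 1ℚ; toℚᵘ)
import Data.Rational.Properties as ℚ
open import Data.Rational.Unnormalised.Base as ℚᵘ using (mkℚᵘ; *≡*)
import Data.Rational.Unnormalised.Properties as ℚᵘ
open import Data.Sum.Base using (_⊎_; inj₁; inj₂; [_,_]′)
open import Data.Vec.Base as Vec using (Vec; []; _∷_; lookup; tabulate)
open import Data.Vec.Properties using (tabulate∘lookup)
open import Data.Vec.Relation.Binary.Pointwise.Inductive using (Pointwise; []; _∷_)
open import Function.Base using (_∘_; _$_)
open import Relation.Binary.Definitions using (tri<; tri≈; tri>)
open import Relation.Binary.PropositionalEquality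
open import Relation.Nullary using (¬_; Dec; yes; no; contradiction)
open import Relation.Nullary.Decidable using (map′; decidable-stable)
open import Relation.Unary using (Pred; _∈_; _⊆_; _≐_)
open import Algebra.Properties.Semiring.Sum +-*-semiring
  renaming (sum to ∑) using (∑-distrib-+; sum-cong-≗; sum-replicate-zero; *-distribˡ-sum; *-distribʳ-sum)
open import Algebra.Properties.CommutativeSemigroup *-commutativeSemigroup using (x∙yz≈y∙xz)
open import Algebra.Properties.CommutativeSemigroup (CommutativeMonoid.commutativeSemigroup ℚ.*-1-commutativeMonoid)
  using (xy∙z≈xz∙y)

-- Computable functions

-- The obstacle is the form of `measure`: a supremum over all antichains of cylinders inside an open
-- set, most of them unrelated to the cylinders that generate it. A supermartingale `V` that is at
-- least D on every cylinder inside the set deals with all of them at once, since Kraft's inequality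
-- weighted by `V` bounds the measure by V []/D. This bound serves for both tests, where `V` adds up
-- the capitals of gamblers betting on one letter at prescribed positions, and for the induced
-- measures of ⟦0⟧ and ⟦1⟧, where `V` is a conditional expectation. Only upper bounds on measures
-- are computed. A lower bound would call for explicit antichains inside F⁻¹⟦0⟧; instead, the
-- additivity of the supposed random measure turns the upper bound for ⟦1⟧ into a lower bound for
-- ⟦0⟧. Both tests have one shape: one of T i families of len i positions carries a fixed letter
-- throughout. Hence `random-escapes` serves the ternary and the binary sequence alike.

⇓-functional : ∀ {n} {e : Rec n} {as u v} → e [ as ]⇓ u → e [ as ]⇓ v → u ≡ v
⇓-functionals : ∀ {m n} {gs : Vec (Rec n) m} {as us vs} →
  Pointwise (λ g b → g [ as ]⇓ b) gs us → Pointwise (λ g b → g [ as ]⇓ b) gs vs → us ≡ vs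

⇓-functional zer⇓ zer⇓ = refl
⇓-functional succ⇓ succ⇓ = refl
⇓-functional (proj⇓ i) (proj⇓ .i) = refl
⇓-functional (comp⇓ ps p) (comp⇓ qs q) with refl ← ⇓-functionals ps qs = ⇓-functional p q
⇓-functional (prec0 p) (prec0 q) = ⇓-functional p q
⇓-functional (precS p p′) (precS q q′) with refl ← ⇓-functional p q = ⇓-functional p′ q′
⇓-functional (mu⇓ {k = k} p ps) (mu⇓ {k = l} q qs) with <-cmp k l
... | tri≈ _ k≡l _ = k≡l
... | tri< k<l _ _ with () ← ⇓-functional p (proj₂ (qs k k<l))
... | tri> _ _ l<k with () ← ⇓-functional q (proj₂ (ps _ l<k))

⇓-functionals [] [] = refl
⇓-functionals (p ∷ ps) (q ∷ qs) = cong₂ _∷_ (⇓-functional p q) (⇓-functionals ps qs)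

projections⇓ : ∀ {m n} (as : Vec ℕ n) (ι : Fin m → Fin n) →
  Pointwise (λ g b → g [ as ]⇓ b) (tabulate (proj ∘ ι)) (tabulate (lookup as ∘ ι))
projections⇓ {zero}  as ι = []
projections⇓ {suc m} as ι = proj⇓ (ι 0F) ∷ projections⇓ as (ι ∘ Fin.suc)

Computable : ∀ {n} → (Vec ℕ n → ℕ) → Set
Computable f = ∃[ e ] ∀ as → e [ as ]⇓ f as

Computable₁ : (ℕ → ℕ) → Set
Computable₁ f = ∃[ e ] ∀ a → e [ a ∷ [] ]⇓ f a

Computable₂ : (ℕ → ℕ → ℕ) → Set
Computable₂ f = ∃[ e ] ∀ a b → e [ a ∷ b ∷ [] ]⇓ f a b

Computable₃ : (ℕ → ℕ → ℕ → ℕ) → Set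
Computable₃ f = ∃[ e ] ∀ a b c → e [ a ∷ b ∷ c ∷ [] ]⇓ f a b c

-- A sum vanishes exactly when all its terms do, so this is the bounded universal quantifier of the
-- tests. It also adds up capitals and gives a number above finitely many positions.
sum< : ℕ → (ℕ → ℕ) → ℕ
sum< zero    f = 0
sum< (suc k) f = sum< k f + f k

private variable
  n : ℕ
  f g k : Vec ℕ n → ℕ
  h : Vec ℕ (suc n) → ℕ

var : (i : Fin n) → Computable (λ as → lookup as i)
var i = proj i , λ _ → proj⇓ i

lift₁ : ∀ {F} → Computable₁ F → Computable f → Computable (λ as → F (f as))
lift₁ (e , p) (d , q) = comp e (d ∷ []) , λ as → comp⇓ (q as ∷ []) (p _)

lift₂ : ∀ {F} → Computable₂ F → Computable f → Computable g → Computable (λ as → F (f as) (g as))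
lift₂ (e , p) (d , q) (d′ , q′) = comp e (d ∷ d′ ∷ []) , λ as → comp⇓ (q as ∷ q′ as ∷ []) (p _ _)

lift₃ : ∀ {F} → Computable₃ F →
  Computable f → Computable g → Computable k → Computable (λ as → F (f as) (g as) (k as))
lift₃ (e , p) (d , q) (d′ , q′) (d″ , q″) = comp e (d ∷ d′ ∷ d″ ∷ []) , λ as → comp⇓ (q as ∷ q′ as ∷ q″ as ∷ []) (p _ _ _)

bind : Computable h → Computable f → Computable (λ as → h (f as ∷ as))
bind (e , p) (d , q) = comp e (d ∷ tabulate proj) , λ as →
  comp⇓ (q as ∷ subst (Pointwise _ _) (tabulate∘lookup as) (projections⇓ as (λ i → i))) (p _)

const-computable : ∀ k → Computable {n} (λ _ → k)
const-computable zero    = zer , λ _ → zer⇓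
const-computable (suc k) = lift₁ (succ , λ _ → succ⇓) (const-computable k)

fold-computable : ∀ {F} → Computable₁ F → Computable₂ (λ k a → fold a F k)
fold-computable {F} (e , p) = prec (proj 0F) (comp e (proj 1F ∷ [])) , go
  where
  go : ∀ k a → _ [ k ∷ a ∷ [] ]⇓ fold a F k
  go zero    a = prec0 (proj⇓ _)
  go (suc k) a = precS (go k a) (comp⇓ (proj⇓ _ ∷ []) (p _))

+-computable : Computable₂ _+_
+-computable = prec (proj 0F) (comp succ (proj 1F ∷ [])) , go
  where
  go : ∀ k a → _ [ k ∷ a ∷ [] ]⇓ (k + a)
  go zero    a = prec0 (proj⇓ _)
  go (suc k) a = precS (go k a) (comp⇓ (proj⇓ _ ∷ []) succ⇓)

*-computable : Computable₂ _*_
*-computable = prec zer (comp (proj₁ +-computable) (proj 2F ∷ proj 1F ∷ [])) , go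
  where
  go : ∀ k a → _ [ k ∷ a ∷ [] ]⇓ (k * a)
  go zero    a = prec0 zer⇓
  go (suc k) a = precS (go k a) (comp⇓ (proj⇓ _ ∷ proj⇓ _ ∷ []) (proj₂ +-computable _ _))

pred-computable : Computable₁ pred
pred-computable = prec zer (proj 0F) , go
  where
  go : ∀ k → _ [ k ∷ [] ]⇓ pred k
  go zero    = prec0 zer⇓
  go (suc k) = precS (go k) (proj⇓ _)

∸-computable : Computable₂ _∸_
∸-computable = comp (prec (proj 0F) (comp (proj₁ pred-computable) (proj 1F ∷ []))) (proj 1F ∷ proj 0F ∷ []) ,
  λ a k → comp⇓ (proj⇓ _ ∷ proj⇓ _ ∷ []) (go k a)
  where
  go : ∀ k a → _ [ k ∷ a ∷ [] ]⇓ (a ∸ k)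
  go zero    a = prec0 (proj⇓ _)
  go (suc k) a rewrite sym (pred[m∸n]≡m∸[1+n] a k) =
    precS (go k a) (comp⇓ (proj⇓ _ ∷ []) (proj₂ pred-computable _))

^-computable : ∀ b → Computable₁ (b ^_)
^-computable b with const-computable b
... | e , p = prec (comp succ (zer ∷ [])) (comp (proj₁ *-computable) (e ∷ proj 1F ∷ [])) , go
  where
  go : ∀ k → _ [ k ∷ [] ]⇓ (b ^ k)
  go zero    = prec0 (comp⇓ (zer⇓ ∷ []) succ⇓)
  go (suc k) = precS (go k) (comp⇓ (p _ ∷ proj⇓ _ ∷ []) (proj₂ *-computable _ _))

sum<-computable : Computable h → Computable f → Computable (λ as → sum< (f as) (λ j → h (j ∷ as)))
sum<-computable {h = h} (e , p) = bind {h = λ as → sum< (Vec.head as) (λ j → h (j ∷ Vec.tail as))} (code , λ { (k ∷ as) → go k as })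
  where
  code : Rec _
  code = prec zer (comp (proj₁ +-computable) (proj 1F ∷ comp e (proj 0F ∷ tabulate (λ i → proj (Fin.suc (Fin.suc i)))) ∷ []))
  rest⇓ : ∀ k u as → Pointwise (λ g b → g [ k ∷ u ∷ as ]⇓ b) (tabulate (λ i → proj (Fin.suc (Fin.suc i)))) as
  rest⇓ k u as = subst (Pointwise _ _) (tabulate∘lookup as) (projections⇓ (k ∷ u ∷ as) (λ i → Fin.suc (Fin.suc i)))
  go : ∀ k as → code [ k ∷ as ]⇓ sum< k (λ j → h (j ∷ as))
  go zero    as = prec0 zer⇓
  go (suc k) as = precS (go k as)
    (comp⇓ (proj⇓ _ ∷ comp⇓ (proj⇓ _ ∷ rest⇓ _ _ as) (p _) ∷ []) (proj₂ +-computable _ _))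

nonzero-value : ∀ {n} {e : Rec n} {as v} → e [ as ]⇓ v → v ≢ 0 → ∃[ u ] e [ as ]⇓ suc u
nonzero-value {v = zero}  _ v≢0 = contradiction refl v≢0
nonzero-value {v = suc u} p _   = u , p

-- Unbounded search computes a function from its characterisation as a least zero; quotients and
-- depths are obtained in this way.
least-computable : Computable h → (∀ as → h (f as ∷ as) ≡ 0) → (∀ as j → j < f as → h (j ∷ as) ≢ 0) → Computable f
least-computable {f = f} (e , p) zero-at nonzero-below = mu e , λ as →
  mu⇓ (subst (e [ f as ∷ as ]⇓_) (zero-at as) (p _)) (λ j j<f → nonzero-value (p _) (nonzero-below as j j<f))

least-zero : (F : ℕ → ℕ) → ∀ k → F k ≡ 0 → ∃[ l ] F l ≡ 0 × (∀ j → j < l → F j ≢ 0)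
least-zero F k Fk≡0 = [ (λ z → z) , (λ none → contradiction Fk≡0 (none k ≤-refl)) ]′ (go (suc k))
  where
  go : ∀ k → (∃[ l ] F l ≡ 0 × (∀ j → j < l → F j ≢ 0)) ⊎ (∀ j → j < k → F j ≢ 0)
  go zero = inj₂ λ _ ()
  go (suc k) with go k
  ... | inj₁ found = inj₁ found
  ... | inj₂ none with F k ≟ 0
  ...   | yes Fk≡0 = inj₁ (k , Fk≡0 , none)
  ...   | no Fk≢0  = inj₂ λ j j<1+k → [ none j , (λ { refl → Fk≢0 }) ]′ (m≤n⇒m<n∨m≡n (s≤s⁻¹ j<1+k))

-- Passes from a decidable relation to the domain of a partial function, the form in which tests are
-- given. A given zero need not be the first, hence `least-zero`; conversely, determinism of
-- evaluation identifies the value found by the search with that of `h`.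
semidecide : Computable {suc n} h → ∃[ e ] ∀ as →
  ((∃[ t ] h (t ∷ as) ≡ 0) → e [ as ]↓) × (e [ as ]↓ → ∃[ t ] h (t ∷ as) ≡ 0)
semidecide {h = h} (e , p) = mu e , λ as → to as , from as
  where
  to : ∀ as → (∃[ t ] h (t ∷ as) ≡ 0) → mu e [ as ]↓
  to as (t , ht≡0) with l , hl≡0 , below ← least-zero (λ t → h (t ∷ as)) t ht≡0 =
    l , mu⇓ (subst (e [ l ∷ as ]⇓_) hl≡0 (p _)) (λ j j<l → nonzero-value (p _) (below j j<l))
  from : ∀ as → mu e [ as ]↓ → ∃[ t ] h (t ∷ as) ≡ 0
  from as (k , mu⇓ q _) = k , ⇓-functional (p _) q

computable₁ : ∀ {F} → Computable {1} (λ as → F (lookup as 0F)) → Computable₁ F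
computable₁ (e , p) = e , λ a → p (a ∷ [])

computable₂ : ∀ {F} → Computable {2} (λ as → F (lookup as 0F) (lookup as 1F)) → Computable₂ F
computable₂ (e , p) = e , λ a b → p (a ∷ b ∷ [])

computable₃ : ∀ {F} → Computable {3} (λ as → F (lookup as 0F) (lookup as 1F) (lookup as 2F)) → Computable₃ F
computable₃ (e , p) = e , λ a b c → p (a ∷ b ∷ c ∷ [])

sum<-zero : ∀ N {F} → (∀ j → j < N → F j ≡ 0) → sum< N F ≡ 0
sum<-zero zero    _ = refl
sum<-zero (suc N) z = cong₂ _+_ (sum<-zero N (λ j j<N → z j (m<n⇒m<1+n j<N))) (z N ≤-refl)

sum<-zero⁻¹ : ∀ N {F} → sum< N F ≡ 0 → ∀ j → j < N → F j ≡ 0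
sum<-zero⁻¹ (suc N) {F} eq j j<1+N with m≤n⇒m<n∨m≡n (s≤s⁻¹ j<1+N)
... | inj₁ j<N  = sum<-zero⁻¹ N (m+n≡0⇒m≡0 (sum< N F) eq) j j<N
... | inj₂ refl = m+n≡0⇒n≡0 (sum< N F) eq

-- Codes of strings

module Codes (n : ℕ) .{{_ : NonZero n}} where

  -- Codes are bijective base-n numerals: the children of c are n·c + 1, ..., n·c + n, so the last
  -- letter is removed by dividing c - 1 by n. The root is its own parent.
  parent : ℕ → ℕ
  parent c = pred c / n

  index-suc : ∀ (y : Seq n) L → index (y ↾ suc L) ≡ n * index (y ↾ L) + suc (toℕ (y L))
  index-suc y L = trans (cong index (sym (applyUpTo-∷ʳ y L))) (foldl-∷ʳ _ 0 (y L) (y ↾ L))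

  parent-child : ∀ c (a : Fin n) → parent (n * c + suc (toℕ a)) ≡ c
  parent-child c a = begin
    pred (n * c + suc (toℕ a)) / n ≡⟨ cong (λ m → pred m / n) (+-suc (n * c) (toℕ a)) ⟩
    (n * c + toℕ a) / n            ≡⟨ cong (λ m → (m + toℕ a) / n) (*-comm n c) ⟩
    (c * n + toℕ a) / n            ≡⟨ +-distrib-/-∣ˡ (toℕ a) (n∣m*n c) ⟩
    c * n / n + toℕ a / n          ≡⟨ cong₂ _+_ (m*n/n≡m c n) (m<n⇒m/n≡0 (toℕ<n a)) ⟩
    c + 0                          ≡⟨ +-identityʳ c ⟩
    c                              ∎
    where open ≡-Reasoning

  parent< : ∀ c → parent (suc c) < suc c
  parent< c = s≤s (m/n≤m c n)

  parent-bound : ∀ c → c ≤ n * suc (parent c)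
  parent-bound zero    = z≤n
  parent-bound (suc c) = begin
    suc c                       ≡⟨ cong suc (m≡m%n+[m/n]*n c n) ⟩
    suc (c % n) + c / n * n     ≤⟨ +-monoˡ-≤ _ (m%n<n c n) ⟩
    suc (c / n) * n             ≡⟨ *-comm (suc (c / n)) n ⟩
    n * suc (c / n)             ∎
    where open ≤-Reasoning

  -- parent c is the least q with c ≤ n * (q + 1).
  parent-computable : Computable₁ parent
  parent-computable = computable₁ (least-computable
    (lift₂ ∸-computable (var 1F) (lift₂ *-computable (const-computable n) (lift₁ (succ , λ _ → succ⇓) (var 0F))))
    (λ { (c ∷ []) → m≤n⇒m∸n≡0 (parent-bound c) })
    (λ { (c ∷ []) q q<p eq → lower c q q<p (m∸n≡0⇒m≤n eq) }))
    where
    lower : ∀ c q → q < parent c → ¬ c ≤ n * suc q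
    lower zero    q q<p c≤ = contradiction (≤-<-trans z≤n (<-≤-trans q<p (m/n≤m 0 n))) λ ()
    lower (suc c) q q<p c≤ = <-irrefl refl (begin-strict
      c             <⟨ c≤ ⟩
      n * suc q     ≡⟨ *-comm n (suc q) ⟩
      suc q * n     ≤⟨ *-monoˡ-≤ n q<p ⟩
      c / n * n     ≤⟨ m/n*n≤m c n ⟩
      c             ∎)
      where open ≤-Reasoning

  ancestor : ℕ → ℕ → ℕ
  ancestor k c = fold c parent k

  ancestor-computable : Computable₂ ancestor
  ancestor-computable = fold-computable parent-computable

  -- Truncated subtraction is right because both sides stay at the root once k exceeds L.
  ancestor-index : ∀ (y : Seq n) k L → ancestor k (index (y ↾ L)) ≡ index (y ↾ (L ∸ k))
  ancestor-index y zero    L = refl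
  ancestor-index y (suc k) L rewrite ancestor-index y k L | sym (pred[m∸n]≡m∸[1+n] L k) = go (L ∸ k)
    where
    go : ∀ m → parent (index (y ↾ m)) ≡ index (y ↾ pred m)
    go zero    = n≤0⇒n≡0 (m/n≤m 0 n)
    go (suc m) = trans (cong parent (index-suc y m)) (parent-child _ (y m))

  -- A step to the parent lowers a nonzero code by at least one. So the root is reached within c
  -- steps, and codes strictly decrease on the way to it.
  ancestor≤∸ : ∀ k c → ancestor k c ≤ c ∸ k
  ancestor≤∸ zero    c = ≤-refl
  ancestor≤∸ (suc k) c with ancestor k c | ancestor≤∸ k c
  ... | zero  | _  = subst (_≤ _) (sym (n≤0⇒n≡0 (m/n≤m 0 n))) z≤n
  ... | suc d | le = subst (parent (suc d) ≤_) (pred[m∸n]≡m∸[1+n] c k) (≤-trans (s≤s⁻¹ (parent< d)) (pred-mono-≤ le))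

  abstract
    depth-spec : ∀ c → ∃[ l ] ancestor l c ≡ 0 × (∀ j → j < l → ancestor j c ≢ 0)
    depth-spec c = least-zero (λ k → ancestor k c) c
      (n≤0⇒n≡0 (≤-trans (ancestor≤∸ c c) (≤-reflexive (n∸n≡0 c))))

  depth : ℕ → ℕ
  depth c = proj₁ (depth-spec c)

  depth-zero : ∀ c → ancestor (depth c) c ≡ 0
  depth-zero c = proj₁ (proj₂ (depth-spec c))

  depth-least : ∀ c j → j < depth c → ancestor j c ≢ 0
  depth-least c = proj₂ (proj₂ (depth-spec c))

  depth-computable : Computable₁ depth
  depth-computable = computable₁ (least-computable
    (lift₂ ancestor-computable (var 0F) (var 1F))
    (λ { (c ∷ []) → depth-zero c })
    (λ { (c ∷ []) → depth-least c }))

  index-zero⁻¹ : ∀ (y : Seq n) L → index (y ↾ L) ≡ 0 → L ≡ 0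
  index-zero⁻¹ y zero    _  = refl
  index-zero⁻¹ y (suc L) eq = contradiction (m+n≡0⇒n≡0 (n * index (y ↾ L)) (trans (sym (index-suc y L)) eq)) λ ()

  depth-index : ∀ (y : Seq n) L → depth (index (y ↾ L)) ≡ L
  depth-index y L = ≤-antisym
    (≮⇒≥ λ L<d → depth-least (index (y ↾ L)) L L<d (trans (ancestor-index y L L) (cong (λ k → index (y ↾ k)) (n∸n≡0 L))))
    (m∸n≡0⇒m≤n (index-zero⁻¹ y (L ∸ d) (trans (sym (ancestor-index y d L)) (depth-zero (index (y ↾ L))))))
    where d = depth (index (y ↾ L))

  distance : ℕ → ℕ → ℕ
  distance a b = (a ∸ b) + (b ∸ a)

  distance-computable : Computable₂ distance
  distance-computable = computable₂
    (lift₂ +-computable (lift₂ ∸-computable (var 0F) (var 1F)) (lift₂ ∸-computable (var 1F) (var 0F)))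

  distance-refl : ∀ a → distance a a ≡ 0
  distance-refl a = cong₂ _+_ (n∸n≡0 a) (n∸n≡0 a)

  distance-zero⁻¹ : ∀ a b → distance a b ≡ 0 → a ≡ b
  distance-zero⁻¹ a b eq = ≤-antisym (m∸n≡0⇒m≤n (m+n≡0⇒m≡0 (a ∸ b) eq)) (m∸n≡0⇒m≤n (m+n≡0⇒n≡0 (a ∸ b) eq))

  -- Zero exactly when the string with code c has the letter b at position p.
  -- The ancestors compared are its prefixes of lengths p + 1 and p; a string
  -- of length at most p is compared with its own child.
  mismatch : ℕ → ℕ → ℕ → ℕ
  mismatch b p c = distance (ancestor (pred (depth c ∸ p)) c) (n * ancestor (depth c ∸ p) c + suc b)

  mismatch-computable : ∀ b → Computable₂ (mismatch b)
  mismatch-computable b = computable₂ (lift₂ distance-computable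
    (lift₂ ancestor-computable (lift₁ pred-computable height) (var 1F))
    (lift₂ +-computable (lift₂ *-computable (const-computable n) (lift₂ ancestor-computable height (var 1F))) (const-computable (suc b))))
    where
    height : Computable (λ as → depth (lookup as 1F) ∸ lookup as 0F)
    height = lift₂ ∸-computable (lift₁ depth-computable (var 1F)) (var 0F)

  mismatch-< : ∀ b p (y : Seq n) L → p < L →
    mismatch b p (index (y ↾ L)) ≡ distance (n * index (y ↾ p) + suc (toℕ (y p))) (n * index (y ↾ p) + suc b)
  mismatch-< b p y L p<L rewrite depth-index y L | ancestor-index y (L ∸ p) L | ancestor-index y (pred (L ∸ p)) L
    | m∸[m∸n]≡n (<⇒≤ p<L) | pred[m∸n]≡m∸[1+n] L p | m∸[m∸n]≡n p<L | index-suc y p = refl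

  mismatch-zero : ∀ b p (y : Seq n) L → p < L → y p ≡ b → mismatch (toℕ b) p (index (y ↾ L)) ≡ 0
  mismatch-zero b p y L p<L refl = trans (mismatch-< (toℕ b) p y L p<L) (distance-refl (n * index (y ↾ p) + suc (toℕ (y p))))

  mismatch-zero⁻¹ : ∀ b p (y : Seq n) L → mismatch (toℕ b) p (index (y ↾ L)) ≡ 0 → y p ≡ b
  mismatch-zero⁻¹ b p y L eq with p <? L
  ... | yes p<L = toℕ-injective (suc-injective (+-cancelˡ-≡ (n * index (y ↾ p)) _ _
                    (distance-zero⁻¹ _ _ (trans (sym (mismatch-< (toℕ b) p y L p<L)) eq))))
  -- A string too short to have a position p never passes, as its code is smaller than that of any
  -- of its children.
  ... | no  p≮L rewrite depth-index y L | m≤n⇒m∸n≡0 (≮⇒≥ p≮L) =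
    contradiction (distance-zero⁻¹ _ (n * index (y ↾ L) + suc (toℕ b)) eq) (<⇒≢ (begin-strict
      index (y ↾ L)                     ≤⟨ m≤n*m (index (y ↾ L)) n ⟩
      n * index (y ↾ L)                 <⟨ m<m+n _ (s≤s z≤n) ⟩
      n * index (y ↾ L) + suc (toℕ b)   ∎))
    where open ≤-Reasoning

-- Kraft's inequality for supermartingales

∑-mono-≤ : ∀ {n} {f g : Fin n → ℕ} → (∀ a → f a ≤ g a) → ∑ f ≤ ∑ g
∑-mono-≤ {zero}  f≤g = z≤n
∑-mono-≤ {suc n} f≤g = +-mono-≤ (f≤g 0F) (∑-mono-≤ (f≤g ∘ Fin.suc))

∑-const : ∀ n c → ∑ {n} (λ _ → c) ≡ n * c
∑-const zero    c = refl
∑-const (suc n) c = cong (λ k → c + k) (∑-const n c)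

if-equal : ∀ {n} → Fin n → Fin n → ℕ → ℕ
if-equal a b c with a ≟ᶠ b
... | yes _ = c
... | no  _ = 0

if-equal-suc : ∀ {n} (a b : Fin n) c → if-equal (Fin.suc a) (Fin.suc b) c ≡ if-equal a b c
if-equal-suc a b c with a ≟ᶠ b
... | yes _ = refl
... | no  _ = refl

∑-if-equal : ∀ {n} (b : Fin n) c → ∑ (λ a → if-equal a b c) ≡ c
∑-if-equal {suc n} 0F          c = trans (cong (λ k → c + k) (sum-replicate-zero n)) (+-identityʳ c)
∑-if-equal {suc n} (Fin.suc b) c = trans (sum-cong-≗ (λ a → if-equal-suc a b c)) (∑-if-equal b c)

-- The Brzozowski derivative of the finite language `A` by the letter `a`.
derivative : Fin n → List (Str n) → List (Str n)
derivative a []            = []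
derivative a ([] ∷ A)      = derivative a A
derivative a ((b ∷ σ) ∷ A) with a ≟ᶠ b
... | yes _ = σ ∷ derivative a A
... | no  _ = derivative a A

derivative-All : ∀ {P Q : Str n → Set} a → (∀ σ → P (a ∷ σ) → Q σ) → ∀ {A} → All P A → All Q (derivative a A)
derivative-All a f []                   = []
derivative-All a f {[] ∷ A}      (_ ∷ ps) = derivative-All a f ps
derivative-All a f {(b ∷ σ) ∷ A} (p ∷ ps) with a ≟ᶠ b
... | yes refl = f σ p ∷ derivative-All a f ps
... | no  _    = derivative-All a f ps

derivative-Antichain : ∀ a {A : List (Str n)} → Antichain A → Antichain (derivative a A)
derivative-Antichain a []                     = []
derivative-Antichain a {[] ∷ A}      (_ ∷ ps) = derivative-Antichain a ps
derivative-Antichain a {(b ∷ σ) ∷ A} (p ∷ ps) with a ≟ᶠ b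
... | yes refl = derivative-All a (λ τ (p , q) → (λ r → p (refl ∷ r)) , (λ r → q (refl ∷ r))) p ∷ derivative-Antichain a ps
... | no  _    = derivative-Antichain a ps

sum-derivative : ∀ (F : Str n → ℕ) {A} → All (_≢ []) A →
  sum (map F A) ≡ ∑ (λ a → sum (map (λ σ → F (a ∷ σ)) (derivative a A)))
sum-derivative {n} F []                = sym (sum-replicate-zero n)
sum-derivative F {[] ∷ A}      (p ∷ _)  = contradiction refl p
sum-derivative F {(b ∷ σ) ∷ A} (_ ∷ ps) = begin
  F (b ∷ σ) + sum (map F A)
    ≡⟨ cong₂ _+_ (sym (∑-if-equal b _)) (sum-derivative F ps) ⟩
  ∑ (λ a → if-equal a b (F (b ∷ σ))) + ∑ (λ a → sum (map (λ σ → F (a ∷ σ)) (derivative a A)))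
    ≡⟨ ∑-distrib-+ (λ a → if-equal a b (F (b ∷ σ))) _ ⟨
  ∑ (λ a → if-equal a b (F (b ∷ σ)) + sum (map (λ σ → F (a ∷ σ)) (derivative a A)))
    ≡⟨ sum-cong-≗ step ⟨
  ∑ (λ a → sum (map (λ σ → F (a ∷ σ)) (derivative a ((b ∷ σ) ∷ A)))) ∎
  where
  open ≡-Reasoning
  step : ∀ a → sum (map (λ σ → F (a ∷ σ)) (derivative a ((b ∷ σ) ∷ A))) ≡
               if-equal a b (F (b ∷ σ)) + sum (map (λ σ → F (a ∷ σ)) (derivative a A))
  step a with a ≟ᶠ b
  ... | yes refl = refl
  ... | no  _    = refl

-- Ville's notion: the capital V of a bettor at fair odds does not grow on average.
Supermartingale : (Str n → ℕ) → Set
Supermartingale {n} V = ∀ σ → ∑ (λ a → V (σ ∷ʳ a)) ≤ n * V σ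

-- Induction on the length bound: the derivatives of an antichain are antichains of shorter strings,
-- `V` shifted by a letter is again a supermartingale, and the n bounds are averaged at the root.
-- Constant capital 1 gives the usual Kraft inequality; the factor n ^ K keeps everything in ℕ.
kraft : ∀ {V : Str n → ℕ} → Supermartingale V → ∀ K {A} → Antichain A → All (λ σ → length σ ≤ K) A →
  sum (map (λ σ → n ^ (K ∸ length σ) * V σ) A) ≤ n ^ K * V []
kraft sm K {[]} _ _ = z≤n
kraft sm K {[] ∷ []} _ _ = ≤-reflexive (+-identityʳ _)
-- The empty string is a prefix of every string, so it is alone in its antichain.
kraft sm K {[] ∷ _ ∷ _} (((p , _) ∷ _) ∷ _) _ = contradiction [] p
kraft sm zero {(a ∷ σ) ∷ A} _ (() ∷ _)
kraft {n} {V} sm (suc K) {(a ∷ σ) ∷ A} anti@(ps ∷ _) short = begin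
  sum (map (λ σ → n ^ (suc K ∸ length σ) * V σ) ((a ∷ σ) ∷ A))
    -- No other member is empty either, since it would be a prefix of the first one.
    ≡⟨ sum-derivative _ {(a ∷ σ) ∷ A} ((λ ()) ∷ All.map (λ { (_ , q) refl → q [] }) ps) ⟩
  ∑ (λ a → sum (map (λ τ → n ^ (K ∸ length τ) * V (a ∷ τ)) (derivative a ((a₀ ∷ σ) ∷ A))))
    ≤⟨ ∑-mono-≤ (λ a → kraft (λ τ → sm (a ∷ τ)) K (derivative-Antichain a anti) (derivative-All a (λ _ → s≤s⁻¹) short)) ⟩
  ∑ (λ a → n ^ K * V (a ∷ []))
    ≡⟨ *-distribˡ-sum (n ^ K) (λ a → V (a ∷ [])) ⟨
  n ^ K * ∑ (λ a → V (a ∷ []))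
    ≤⟨ *-monoʳ-≤ (n ^ K) (sm []) ⟩
  n ^ K * (n * V [])
    ≡⟨ *-assoc (n ^ K) n (V []) ⟨
  n ^ K * n * V []
    ≡⟨ cong (_* V []) (*-comm (n ^ K) n) ⟩
  n ^ suc K * V [] ∎
  where
  open ≤-Reasoning
  a₀ = a

-- Measures of open sets as rational numbers

toℚᵘ-/ : ∀ i d .{{_ : NonZero d}} → toℚᵘ (i ℚ./ d) ℚᵘ.≃ (i ℚᵘ./ d)
toℚᵘ-/ i (suc d) = ℚ.toℚᵘ-fromℚᵘ (mkℚᵘ i d)

ι : ℕ → ℚ
ι k = + k ℚ./ 1

ι-+ : ∀ a b → ι (a + b) ≡ ι a ℚ.+ ι b
ι-+ a b = ℚ.toℚᵘ-injective $ begin-equality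
  toℚᵘ (ι (a + b))                        ≃⟨ toℚᵘ-/ (+ (a + b)) 1 ⟩
  mkℚᵘ (+ (a + b)) 0                      ≃⟨ *≡* (cong (ℤ._* + 1) (sym (cong₂ ℤ._+_ (ℤ.*-identityʳ (+ a)) (ℤ.*-identityʳ (+ b))))) ⟩
  mkℚᵘ (+ a) 0 ℚᵘ.+ mkℚᵘ (+ b) 0          ≃⟨ ℚᵘ.+-cong (toℚᵘ-/ (+ a) 1) (toℚᵘ-/ (+ b) 1) ⟨
  toℚᵘ (ι a) ℚᵘ.+ toℚᵘ (ι b)              ≃⟨ ℚ.toℚᵘ-homo-+ (ι a) (ι b) ⟨
  toℚᵘ (ι a ℚ.+ ι b)                      ∎
  where open ℚᵘ.≤-Reasoning

ι-* : ∀ a b → ι (a * b) ≡ ι a ℚ.* ι b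
ι-* a b = ℚ.toℚᵘ-injective $ begin-equality
  toℚᵘ (ι (a * b))                        ≃⟨ toℚᵘ-/ (+ (a * b)) 1 ⟩
  mkℚᵘ (+ (a * b)) 0                      ≃⟨ *≡* (cong (ℤ._* + 1) (ℤ.pos-* a b)) ⟩
  mkℚᵘ (+ a) 0 ℚᵘ.* mkℚᵘ (+ b) 0          ≃⟨ ℚᵘ.*-cong (toℚᵘ-/ (+ a) 1) (toℚᵘ-/ (+ b) 1) ⟨
  toℚᵘ (ι a) ℚᵘ.* toℚᵘ (ι b)              ≃⟨ ℚ.toℚᵘ-homo-* (ι a) (ι b) ⟨
  toℚᵘ (ι a ℚ.* ι b)                      ∎
  where open ℚᵘ.≤-Reasoning

/-*-cancel : ∀ a d .{{_ : NonZero d}} → (+ a ℚ./ d) ℚ.* ι d ≡ ι a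
/-*-cancel a d@(suc d-1) = ℚ.toℚᵘ-injective $ begin-equality
  toℚᵘ ((+ a ℚ./ d) ℚ.* ι d)              ≃⟨ ℚ.toℚᵘ-homo-* (+ a ℚ./ d) (ι d) ⟩
  toℚᵘ (+ a ℚ./ d) ℚᵘ.* toℚᵘ (ι d)        ≃⟨ ℚᵘ.*-cong (toℚᵘ-/ (+ a) d) (toℚᵘ-/ (+ d) 1) ⟩
  mkℚᵘ (+ a) d-1 ℚᵘ.* mkℚᵘ (+ d) 0        ≃⟨ *≡* (trans (ℤ.*-assoc (+ a) (+ d) (+ 1)) (cong (λ e → + a ℤ.* e) (sym (ℤ.pos-* d 1)))) ⟩
  mkℚᵘ (+ a) 0                            ≃⟨ toℚᵘ-/ (+ a) 1 ⟨
  toℚᵘ (ι a)                              ∎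
  where open ℚᵘ.≤-Reasoning

ι-mono-≤ : ∀ {a b} → a ≤ b → ι a ℚ.≤ ι b
ι-mono-≤ {a} {b} a≤b = ℚ.toℚᵘ-cancel-≤ $ begin
  toℚᵘ (ι a)    ≃⟨ toℚᵘ-/ (+ a) 1 ⟩
  mkℚᵘ (+ a) 0  ≤⟨ ℚᵘ.*≤* (ℤ.*-monoʳ-≤-nonNeg (+ 1) (ℤ.+≤+ a≤b)) ⟩
  mkℚᵘ (+ b) 0  ≃⟨ toℚᵘ-/ (+ b) 1 ⟨
  toℚᵘ (ι b)    ∎
  where open ℚᵘ.≤-Reasoning

ι-mono-< : ∀ {a b} → a < b → ι a ℚ.< ι b
ι-mono-< {a} {b} a<b = ℚ.toℚᵘ-cancel-< $ begin-strict
  toℚᵘ (ι a)    ≃⟨ toℚᵘ-/ (+ a) 1 ⟩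
  mkℚᵘ (+ a) 0  <⟨ ℚᵘ.*<* (ℤ.*-monoʳ-<-pos (+ 1) (ℤ.+<+ a<b)) ⟩
  mkℚᵘ (+ b) 0  ≃⟨ toℚᵘ-/ (+ b) 1 ⟨
  toℚᵘ (ι b)    ∎
  where open ℚᵘ.≤-Reasoning

ι-cancel-≤ : ∀ {a b} → ι a ℚ.≤ ι b → a ≤ b
ι-cancel-≤ ιa≤ιb = ≮⇒≥ λ b<a → ℚ.<-irrefl refl (ℚ.<-≤-trans (ι-mono-< b<a) ιa≤ιb)

ι-positive : ∀ d .{{_ : NonZero d}} → ℚ.Positive (ι d)
ι-positive (suc d) = ℚ.positive (ι-mono-< {0} {suc d} (s≤s z≤n))

/-cancel-≤ : ∀ {p q} d .{{_ : NonZero d}} → p ℚ.* ι d ℚ.≤ q ℚ.* ι d → p ℚ.≤ q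
/-cancel-≤ d = ℚ.*-cancelʳ-≤-pos (ι d) {{ι-positive d}}

*ι-mono-≤ : ∀ {p q} d → p ℚ.≤ q → p ℚ.* ι d ℚ.≤ q ℚ.* ι d
*ι-mono-≤ d = ℚ.*-monoʳ-≤-nonNeg (ι d) {{ℚ.nonNegative (ι-mono-≤ {0} {d} z≤n)}}

common-bound : ∀ {n} (A : List (Str n)) → ∃[ K ] All (λ σ → length σ ≤ K) A
common-bound []      = 0 , []
common-bound (σ ∷ A) with K , ps ← common-bound A =
  length σ ⊔ K , m≤m⊔n (length σ) K ∷ All.map (λ p → ≤-trans p (m≤n⊔m (length σ) K)) ps

module _ {n : ℕ} .{{_ : NonZero n}} where

  cylinder-scaled : ∀ {l K} → l ≤ K → (1/ n ^ l) ℚ.* ι (n ^ K) ≡ ι (n ^ (K ∸ l))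
  cylinder-scaled {l} {K} l≤K = begin
    (1/ n ^ l) ℚ.* ι (n ^ K)                           ≡⟨ cong (λ k → (1/ n ^ l) ℚ.* ι (n ^ k)) (sym (m+[n∸m]≡n l≤K)) ⟩
    (1/ n ^ l) ℚ.* ι (n ^ (l + (K ∸ l)))               ≡⟨ cong (λ k → (1/ n ^ l) ℚ.* ι k) (^-distribˡ-+-* n l (K ∸ l)) ⟩
    (1/ n ^ l) ℚ.* ι (n ^ l * n ^ (K ∸ l))             ≡⟨ cong ((1/ n ^ l) ℚ.*_) (ι-* (n ^ l) (n ^ (K ∸ l))) ⟩
    (1/ n ^ l) ℚ.* (ι (n ^ l) ℚ.* ι (n ^ (K ∸ l)))     ≡⟨ ℚ.*-assoc (1/ n ^ l) (ι (n ^ l)) (ι (n ^ (K ∸ l))) ⟨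
    (1/ n ^ l) ℚ.* ι (n ^ l) ℚ.* ι (n ^ (K ∸ l))       ≡⟨ cong (ℚ._* ι (n ^ (K ∸ l))) (/-*-cancel 1 (n ^ l) {{m^n≢0 n l}}) ⟩
    1ℚ ℚ.* ι (n ^ (K ∸ l))                             ≡⟨ ℚ.*-identityˡ (ι (n ^ (K ∸ l))) ⟩
    ι (n ^ (K ∸ l))                                    ∎
    where open ≡-Reasoning

  cylinders-scaled : ∀ K {A : List (Str n)} → All (λ σ → length σ ≤ K) A →
    sumℚ (map (λ σ → 1/ n ^ length σ) A) ℚ.* ι (n ^ K) ≡ ι (sum (map (λ σ → n ^ (K ∸ length σ)) A))
  cylinders-scaled K [] = ℚ.*-zeroˡ (ι (n ^ K))
  cylinders-scaled K {σ ∷ A} (p ∷ ps) = begin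
    (1/ n ^ length σ ℚ.+ S) ℚ.* ι (n ^ K)                 ≡⟨ ℚ.*-distribʳ-+ (ι (n ^ K)) (1/ n ^ length σ) S ⟩
    (1/ n ^ length σ) ℚ.* ι (n ^ K) ℚ.+ S ℚ.* ι (n ^ K)   ≡⟨ cong₂ ℚ._+_ (cylinder-scaled p) (cylinders-scaled K ps) ⟩
    ι (n ^ (K ∸ length σ)) ℚ.+ ι N                        ≡⟨ ι-+ (n ^ (K ∸ length σ)) N ⟨
    ι (n ^ (K ∸ length σ) + N)                            ∎
    where
    open ≡-Reasoning
    S = sumℚ (map (λ σ → 1/ n ^ length σ) A)
    N = sum (map (λ σ → n ^ (K ∸ length σ)) A)

  -- For any antichain inside `U`, D·Σ n^(-|σ|) ≤ Σ n^(-|σ|)·V σ ≤ V [] by `kraft`. The hypothesis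
  -- concerns every cylinder inside `U`, as an antichain may use any of them.
  measure-bound : ∀ {V : Str n → ℕ} (U : Pred (Seq n) _) D .{{_ : NonZero D}} → Supermartingale V →
    (∀ σ → ⟦ σ ⟧ ⊆ U → D ≤ V σ) → measure U ⊆ rat (+ V [] ℚ./ D)
  measure-bound {V} U D sm large {q} (A , anti , A⊆U , q<S) with K , short ← common-bound A =
    ℚ.<-≤-trans q<S (/-cancel-≤ D (/-cancel-≤ (n ^ K) {{m^n≢0 n K}} (begin
      S ℚ.* ι D ℚ.* ι (n ^ K)             ≡⟨ xy∙z≈xz∙y S (ι D) (ι (n ^ K)) ⟩
      S ℚ.* ι (n ^ K) ℚ.* ι D             ≡⟨ cong (ℚ._* ι D) (cylinders-scaled K short) ⟩
      ι N ℚ.* ι D                         ≡⟨ ι-* N D ⟨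
      ι (N * D)                           ≤⟨ ι-mono-≤ (≤-trans (heavy A⊆U) (kraft sm K anti short)) ⟩
      ι (n ^ K * V [])                    ≡⟨ cong ι (*-comm (n ^ K) (V [])) ⟩
      ι (V [] * n ^ K)                    ≡⟨ ι-* (V []) (n ^ K) ⟩
      ι (V []) ℚ.* ι (n ^ K)              ≡⟨ cong (ℚ._* ι (n ^ K)) (/-*-cancel (V []) D) ⟨
      (+ V [] ℚ./ D) ℚ.* ι D ℚ.* ι (n ^ K) ∎)))
    where
    open ℚ.≤-Reasoning
    S = sumℚ (map (λ σ → 1/ n ^ length σ) A)
    N = sum (map (λ σ → n ^ (K ∸ length σ)) A)
    heavy : ∀ {A} → All (λ σ → ⟦ σ ⟧ ⊆ U) A →
      sum (map (λ σ → n ^ (K ∸ length σ)) A) * D ≤ sum (map (λ σ → n ^ (K ∸ length σ) * V σ) A)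
    heavy [] = z≤n
    heavy {σ ∷ A} (p ∷ ps) = ≤-trans
      (≤-reflexive (*-distribʳ-+ D (n ^ (K ∸ length σ)) _))
      (+-mono-≤ (*-monoʳ-≤ (n ^ (K ∸ length σ)) (large σ p)) (heavy ps))

-- Tests given by a letter at prescribed positions

prod< : ℕ → (ℕ → ℕ) → ℕ
prod< zero    f = 1
prod< (suc k) f = prod< k f * f k

prod<-cong : ∀ m {f g} → (∀ j → j < m → f j ≡ g j) → prod< m f ≡ prod< m g
prod<-cong zero    eq = refl
prod<-cong (suc m) eq = cong₂ _*_ (prod<-cong m (λ j j<m → eq j (m<n⇒m<1+n j<m))) (eq m ≤-refl)

prod<-const : ∀ m c → prod< m (λ _ → c) ≡ c ^ m
prod<-const zero    c = refl
prod<-const (suc m) c = trans (cong (_* c) (prod<-const m c)) (*-comm (c ^ m) c)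

sum<-const : ∀ m c → sum< m (λ _ → c) ≡ m * c
sum<-const zero    c = refl
sum<-const (suc m) c = trans (cong (_+ c) (sum<-const m c)) (+-comm (m * c) c)

sum<-term : ∀ m f {j} → j < m → f j ≤ sum< m f
sum<-term (suc m) f j<1+m with m≤n⇒m<n∨m≡n (s≤s⁻¹ j<1+m)
... | inj₁ j<m  = ≤-trans (sum<-term m f j<m) (m≤m+n _ _)
... | inj₂ refl = m≤n+m _ _

-- A point of ⟦σ⟧. When the filling letter differs from the letter b of a test, b occurs in it only
-- where it occurs in σ.
pad : ∀ {n} → Fin n → Str n → Seq n
pad b′ []      p       = b′
pad b′ (a ∷ σ) zero    = a
pad b′ (a ∷ σ) (suc p) = pad b′ σ p

pad-∈ : ∀ {n} (b′ : Fin n) σ → pad b′ σ ∈ ⟦ σ ⟧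
pad-∈ b′ []      = refl
pad-∈ b′ (a ∷ σ) = cong (a ∷_) (pad-∈ b′ σ)

module _ {n : ℕ} (b : Fin n) where

  -- n times the conditional probability, given ⟦σ⟧, of the letter b at position p.
  factor : ℕ → Str n → ℕ
  factor p       []      = 1
  factor zero    (a ∷ σ) = if-equal a b n
  factor (suc p) (a ∷ σ) = factor p σ

  factor-undetermined : ∀ σ → factor (length σ) σ ≡ 1
  factor-undetermined []      = refl
  factor-undetermined (a ∷ σ) = factor-undetermined σ

  factor-last : ∀ σ a → factor (length σ) (σ ∷ʳ a) ≡ if-equal a b n
  factor-last []      a = refl
  factor-last (c ∷ σ) a = factor-last σ a

  factor-other : ∀ p σ a → p ≢ length σ → factor p (σ ∷ʳ a) ≡ factor p σ
  factor-other zero    []      a p≢0 = contradiction refl p≢0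
  factor-other (suc p) []      a _   = refl
  factor-other zero    (c ∷ σ) a _   = refl
  factor-other (suc p) (c ∷ σ) a p≢l = factor-other p σ a (λ p≡l → p≢l (cong suc p≡l))

  -- A further letter decides only the position `length σ`, which by injectivity concerns at most
  -- one factor. That factor passes from 1 to n for one letter and to 0 for the others, so the
  -- capital is preserved on average.
  supermartingale-factors : ∀ m (pos : ℕ → ℕ) → (∀ {j k} → j < m → k < m → pos j ≡ pos k → j ≡ k) →
    Supermartingale (λ σ → prod< m (λ j → factor (pos j) σ))
  supermartingale-factors zero    pos inj σ = ≤-reflexive (∑-const n 1)
  supermartingale-factors (suc m) pos inj σ with pos m ≟ length σ
  ... | no p≢l = begin
    ∑ (λ a → P (σ ∷ʳ a) * factor (pos m) (σ ∷ʳ a))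
      ≡⟨ sum-cong-≗ (λ a → cong (P (σ ∷ʳ a) *_) (factor-other (pos m) σ a p≢l)) ⟩
    ∑ (λ a → P (σ ∷ʳ a) * factor (pos m) σ)
      ≡⟨ *-distribʳ-sum (factor (pos m) σ) (λ a → P (σ ∷ʳ a)) ⟨
    ∑ (λ a → P (σ ∷ʳ a)) * factor (pos m) σ
      ≤⟨ *-monoˡ-≤ (factor (pos m) σ) (supermartingale-factors m pos
           (λ j<m k<m → inj (m<n⇒m<1+n j<m) (m<n⇒m<1+n k<m)) σ) ⟩
    n * P σ * factor (pos m) σ
      ≡⟨ *-assoc n (P σ) _ ⟩
    n * (P σ * factor (pos m) σ) ∎
    where
    open ≤-Reasoning
    P : Str n → ℕ
    P σ = prod< m (λ j → factor (pos j) σ)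
  ... | yes p≡l = ≤-reflexive (begin
    ∑ (λ a → P (σ ∷ʳ a) * factor (pos m) (σ ∷ʳ a))
      ≡⟨ sum-cong-≗ (λ a → cong₂ _*_ (prod<-cong m (λ j j<m → factor-other (pos j) σ a (others j<m)))
           (trans (cong (λ p → factor p (σ ∷ʳ a)) p≡l) (factor-last σ a))) ⟩
    ∑ (λ a → P σ * if-equal a b n)
      ≡⟨ *-distribˡ-sum (P σ) (λ a → if-equal a b n) ⟨
    P σ * ∑ (λ a → if-equal a b n)
      ≡⟨ cong (P σ *_) (∑-if-equal b n) ⟩
    P σ * n
      ≡⟨ *-comm (P σ) n ⟩
    n * P σ
      ≡⟨ cong (n *_) (*-identityʳ (P σ)) ⟨
    n * (P σ * 1)
      ≡⟨ cong (λ k → n * (P σ * k)) (trans (cong (λ p → factor p σ) p≡l) (factor-undetermined σ)) ⟨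
    n * (P σ * factor (pos m) σ) ∎)
    where
    open ≡-Reasoning
    P : Str n → ℕ
    P σ = prod< m (λ j → factor (pos j) σ)
    others : ∀ {j} → j < m → pos j ≢ length σ
    others {j} j<m pj≡l = <⇒≢ j<m (inj (m<n⇒m<1+n j<m) ≤-refl (trans pj≡l (sym p≡l)))

  factor-pad : ∀ {b′} p σ → b′ ≢ b → pad b′ σ p ≡ b → factor p σ ≡ n
  factor-pad p []      b′≢b eq = contradiction eq b′≢b
  factor-pad (suc p) (a ∷ σ) b′≢b eq = factor-pad p σ b′≢b eq
  factor-pad zero    (a ∷ σ) b′≢b refl with a ≟ᶠ a
  ... | yes _  = refl
  ... | no a≢a = contradiction refl a≢a

supermartingale-sum : ∀ {n} T (V : ℕ → Str n → ℕ) → (∀ t → t < T → Supermartingale (V t)) →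
  Supermartingale (λ σ → sum< T (λ t → V t σ))
supermartingale-sum {n} zero    V sm σ = ≤-reflexive (trans (sum-replicate-zero n) (sym (*-zeroʳ n)))
supermartingale-sum {n} (suc T) V sm σ = begin
  ∑ (λ a → sum< T (λ t → V t (σ ∷ʳ a)) + V T (σ ∷ʳ a))
    ≡⟨ ∑-distrib-+ (λ a → sum< T (λ t → V t (σ ∷ʳ a))) (λ a → V T (σ ∷ʳ a)) ⟩
  ∑ (λ a → sum< T (λ t → V t (σ ∷ʳ a))) + ∑ (λ a → V T (σ ∷ʳ a))
    ≤⟨ +-mono-≤ (supermartingale-sum T V (λ t t<T → sm t (m<n⇒m<1+n t<T)) σ) (sm T ≤-refl σ) ⟩
  n * sum< T (λ t → V t σ) + n * V T σ
    ≡⟨ *-distribˡ-+ n _ (V T σ) ⟨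
  n * (sum< T (λ t → V t σ) + V T σ) ∎
  where open ≤-Reasoning

module _ {n : ℕ} .{{_ : NonZero n}} {b b′ : Fin n} (b′≢b : b′ ≢ b)
  {T len : ℕ → ℕ} {pos : ℕ → ℕ → ℕ → ℕ}
  (T-computable : Computable₁ T) (len-computable : Computable₁ len)
  (pos-computable : Computable₃ pos)
  (pos-injective : ∀ i {t j k} → t < T i → j < len i → k < len i → pos i t j ≡ pos i t k → j ≡ k)
  (small : ∀ i → T i * 2 ^ i ≤ n ^ len i)
  where

  open Codes n

  private
    Meets : ℕ → ℕ → Seq n → Set
    Meets i t x = ∀ j → j < len i → x (pos i t j) ≡ b

    -- The arguments are t, i and the code of a string; t comes first because `semidecide` searches
    -- for it. The first summand vanishes iff t < T i, the second iff the string shows the letter at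
    -- all positions of family t.
    check : Vec ℕ 3 → ℕ
    check as = (suc (lookup as 0F) ∸ T (lookup as 1F)) +
      sum< (len (lookup as 1F)) (λ j → mismatch (toℕ b) (pos (lookup as 1F) (lookup as 0F) j) (lookup as 2F))

    check-computable : Computable check
    check-computable = lift₂ +-computable
      (lift₂ ∸-computable (lift₁ (succ , λ _ → succ⇓) (var 0F)) (lift₁ T-computable (var 1F)))
      (sum<-computable
        {h = λ as → mismatch (toℕ b) (pos (lookup as 2F) (lookup as 1F) (lookup as 0F)) (lookup as 3F)}
        (lift₂ (mismatch-computable (toℕ b)) (lift₃ {F = pos} pos-computable (var 2F) (var 1F) (var 0F)) (var 3F))
        (lift₁ len-computable (var 1F)))

    test : Rec 2
    test = proj₁ (semidecide check-computable)

    accepts : ∀ i x → (∃[ t ] t < T i × Meets i t x) → x ∈ Σ⁰₁ test i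
    accepts i x (t , t<T , meets) = x ↾ L , cong (x ↾_) (length-applyUpTo x L) ,
      proj₁ (proj₂ (semidecide check-computable) (i ∷ index (x ↾ L) ∷ [])) (t ,
        cong₂ _+_ (m≤n⇒m∸n≡0 t<T)
          (sum<-zero (len i) (λ j j<l → mismatch-zero b (pos i t j) x L (sum<-term (len i) (λ j → suc (pos i t j)) j<l) (meets j j<l))))
      -- Exceeds every position of the family, so the prefix of length L already shows all the
      -- letters required.
      where L = sum< (len i) (λ j → suc (pos i t j))

    accepts⁻¹ : ∀ i x → x ∈ Σ⁰₁ test i → ∃[ t ] t < T i × Meets i t x
    accepts⁻¹ i x (σ , x∈σ , halts)
      with t , eq ← proj₂ (proj₂ (semidecide check-computable) (i ∷ index σ ∷ [])) halts =
      t , m∸n≡0⇒m≤n (m+n≡0⇒m≡0 (suc t ∸ T i) eq) , λ j j<l →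
        mismatch-zero⁻¹ b (pos i t j) x (length σ)
          (trans (cong (λ τ → mismatch (toℕ b) (pos i t j) (index τ)) x∈σ)
            (sum<-zero⁻¹ (len i) (m+n≡0⇒n≡0 (suc t ∸ T i) eq) j j<l))

    V : ℕ → Str n → ℕ
    V i σ = sum< (T i) (λ t → prod< (len i) (λ j → factor b (pos i t j) σ))

    -- The inclusion promises a family for each point of the cylinder separately. The point padded
    -- with `b′` has one whose positions all lie within σ, and the gambler on that family has won
    -- every bet.
    large : ∀ i σ → ⟦ σ ⟧ ⊆ Σ⁰₁ test i → n ^ len i ≤ V i σ
    large i σ σ⊆U with t , t<T , meets ← accepts⁻¹ i (pad b′ σ) (σ⊆U (pad-∈ b′ σ)) = begin
      n ^ len i                                      ≡⟨ prod<-const (len i) n ⟨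
      prod< (len i) (λ _ → n)                        ≡⟨ prod<-cong (len i) (λ j j<l → factor-pad b (pos i t j) σ b′≢b (meets j j<l)) ⟨
      prod< (len i) (λ j → factor b (pos i t j) σ)   ≤⟨ sum<-term (T i) (λ t → prod< (len i) (λ j → factor b (pos i t j) σ)) t<T ⟩
      V i σ                                          ∎
      where open ≤-Reasoning

    V-root : ∀ i → V i [] ≡ T i
    V-root i = begin
      sum< (T i) (λ t → prod< (len i) (λ _ → 1))   ≡⟨ sum<-const (T i) _ ⟩
      T i * prod< (len i) (λ _ → 1)                ≡⟨ cong (T i *_) (trans (prod<-const (len i) 1) (^-zeroˡ (len i))) ⟩
      T i * 1                                      ≡⟨ *-identityʳ (T i) ⟩
      T i                                          ∎
      where open ≡-Reasoning

    fraction-small : ∀ i D .{{_ : NonZero D}} → V i [] * 2 ^ i ≤ D → (+ V i [] ℚ./ D) ℚ.≤ 1/ 2 ^ i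
    fraction-small i D le = /-cancel-≤ D (/-cancel-≤ (2 ^ i) {{m^n≢0 2 i}} (begin
      (+ V i [] ℚ./ D) ℚ.* ι D ℚ.* ι (2 ^ i)   ≡⟨ cong (ℚ._* ι (2 ^ i)) (/-*-cancel (V i []) D) ⟩
      ι (V i []) ℚ.* ι (2 ^ i)                 ≡⟨ ι-* (V i []) (2 ^ i) ⟨
      ι (V i [] * 2 ^ i)                       ≤⟨ ι-mono-≤ le ⟩
      ι D                                      ≡⟨ ℚ.*-identityˡ (ι D) ⟨
      ι 1 ℚ.* ι D                              ≡⟨ cong (ℚ._* ι D) (/-*-cancel 1 (2 ^ i) {{m^n≢0 2 i}}) ⟨
      (1/ 2 ^ i) ℚ.* ι (2 ^ i) ℚ.* ι D         ≡⟨ xy∙z≈xz∙y (1/ 2 ^ i) (ι (2 ^ i)) (ι D) ⟩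
      (1/ 2 ^ i) ℚ.* ι D ℚ.* ι (2 ^ i)         ∎))
      where open ℚ.≤-Reasoning

  -- A family of len i distinct positions carries b with probability n^(-len i), so the union over T
  -- i families has measure at most 2^(-i) by `small`.
  random-escapes : ∀ {x} → MLRandom x →
    ¬ (∀ i → ∃[ t ] t < T i × (∀ j → j < len i → x (pos i t j) ≡ b))
  random-escapes {x} random always = random test
    (λ i q∈ → ℚ.<-≤-trans
      (measure-bound (Σ⁰₁ test i) (n ^ len i) {{m^n≢0 n (len i)}}
        (supermartingale-sum (T i) (λ t σ → prod< (len i) (λ j → factor b (pos i t j) σ))
          (λ t t<T → supermartingale-factors b (len i) (pos i t) (pos-injective i t<T)))
        (large i) q∈)
      (fraction-small i (n ^ len i) {{m^n≢0 n (len i)}} (subst (λ k → k * 2 ^ i ≤ n ^ len i) (sym (V-root i)) (small i))))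
    (λ i → accepts i x (always i))

-- Binary expansions

sumℚ-∷ʳ : ∀ qs q → sumℚ (qs ∷ʳ q) ≡ sumℚ qs ℚ.+ q
sumℚ-∷ʳ []       q = trans (ℚ.+-identityʳ q) (sym (ℚ.+-identityˡ q))
sumℚ-∷ʳ (r ∷ qs) q = trans (cong (r ℚ.+_) (sumℚ-∷ʳ qs q)) (sym (ℚ.+-assoc r (sumℚ qs) q))

module _ (c : Seq 2) where

  prefix-value : ℕ → ℕ
  prefix-value zero    = 0
  prefix-value (suc k) = 2 * prefix-value k + toℕ (c k)

  partial : ℕ → ℚ
  partial k = sumℚ (applyUpTo (λ j → ι (toℕ (c j)) ℚ.* (1/ 2 ^ suc j)) k)

  partial-scaled : ∀ k → partial k ℚ.* ι (2 ^ k) ≡ ι (prefix-value k)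
  partial-scaled zero    = refl
  partial-scaled (suc k) = begin
    partial (suc k) ℚ.* ι (2 ^ suc k)
      ≡⟨ cong (λ qs → sumℚ qs ℚ.* ι (2 ^ suc k)) (applyUpTo-∷ʳ term k) ⟨
    sumℚ (applyUpTo term k ∷ʳ term k) ℚ.* ι (2 ^ suc k)
      ≡⟨ cong (ℚ._* ι (2 ^ suc k)) (sumℚ-∷ʳ (applyUpTo term k) (term k)) ⟩
    (partial k ℚ.+ term k) ℚ.* ι (2 ^ suc k)
      ≡⟨ ℚ.*-distribʳ-+ (ι (2 ^ suc k)) (partial k) (term k) ⟩
    partial k ℚ.* ι (2 ^ suc k) ℚ.+ term k ℚ.* ι (2 ^ suc k)
      ≡⟨ cong₂ ℚ._+_ (doubled k) (digit k) ⟩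
    ι (2 * prefix-value k) ℚ.+ ι (toℕ (c k))
      ≡⟨ ι-+ (2 * prefix-value k) (toℕ (c k)) ⟨
    ι (prefix-value (suc k)) ∎
    where
    open ≡-Reasoning
    term : ℕ → ℚ
    term j = ι (toℕ (c j)) ℚ.* (1/ 2 ^ suc j)
    doubled : ∀ k → partial k ℚ.* ι (2 ^ suc k) ≡ ι (2 * prefix-value k)
    doubled k = begin
      partial k ℚ.* ι (2 * 2 ^ k)            ≡⟨ cong (λ j → partial k ℚ.* ι j) (*-comm 2 (2 ^ k)) ⟩
      partial k ℚ.* ι (2 ^ k * 2)            ≡⟨ cong (partial k ℚ.*_) (ι-* (2 ^ k) 2) ⟩
      partial k ℚ.* (ι (2 ^ k) ℚ.* ι 2)      ≡⟨ ℚ.*-assoc (partial k) (ι (2 ^ k)) (ι 2) ⟨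
      partial k ℚ.* ι (2 ^ k) ℚ.* ι 2        ≡⟨ cong (ℚ._* ι 2) (partial-scaled k) ⟩
      ι (prefix-value k) ℚ.* ι 2             ≡⟨ ι-* (prefix-value k) 2 ⟨
      ι (prefix-value k * 2)                 ≡⟨ cong ι (*-comm (prefix-value k) 2) ⟩
      ι (2 * prefix-value k)                 ∎
    digit : ∀ k → term k ℚ.* ι (2 ^ suc k) ≡ ι (toℕ (c k))
    digit k = begin
      term k ℚ.* ι (2 ^ suc k)                              ≡⟨ ℚ.*-assoc (ι (toℕ (c k))) (1/ 2 ^ suc k) (ι (2 ^ suc k)) ⟩
      ι (toℕ (c k)) ℚ.* ((1/ 2 ^ suc k) ℚ.* ι (2 ^ suc k))  ≡⟨ cong (ι (toℕ (c k)) ℚ.*_) (/-*-cancel 1 (2 ^ suc k) {{m^n≢0 2 (suc k)}}) ⟩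
      ι (toℕ (c k)) ℚ.* 1ℚ                                  ≡⟨ ℚ.*-identityʳ (ι (toℕ (c k))) ⟩
      ι (toℕ (c k))                                         ∎

  value-lower : ∀ k d → prefix-value k * 2 ^ d ≤ prefix-value (d + k)
  value-lower k zero    = ≤-reflexive (*-identityʳ (prefix-value k))
  value-lower k (suc d) = begin
    prefix-value k * (2 * 2 ^ d)                      ≡⟨ x∙yz≈y∙xz (prefix-value k) 2 (2 ^ d) ⟩
    2 * (prefix-value k * 2 ^ d)                      ≤⟨ *-monoʳ-≤ 2 (value-lower k d) ⟩
    2 * prefix-value (d + k)                          ≤⟨ m≤m+n _ _ ⟩
    2 * prefix-value (d + k) + toℕ (c (d + k))        ∎
    where
    open ≤-Reasoning

  -- The extreme case is d further digits 1; their sum 2^d - 1 is absorbed by the `suc`.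
  value-upper : ∀ k d → suc (prefix-value (d + k)) ≤ suc (prefix-value k) * 2 ^ d
  value-upper k zero    = ≤-reflexive (sym (*-identityʳ (suc (prefix-value k))))
  value-upper k (suc d) = begin
    suc (2 * prefix-value (d + k) + toℕ (c (d + k)))  ≤⟨ s≤s (+-monoʳ-≤ _ (toℕ≤pred[n] (c (d + k)))) ⟩
    suc (2 * prefix-value (d + k) + 1)                ≡⟨ solve 1 (λ v → con 1 :+ (con 2 :* v :+ con 1) := con 2 :* (con 1 :+ v)) refl (prefix-value (d + k)) ⟩
    2 * suc (prefix-value (d + k))                    ≤⟨ *-monoʳ-≤ 2 (value-upper k d) ⟩
    2 * (suc (prefix-value k) * 2 ^ d)                ≡⟨ x∙yz≈y∙xz 2 (suc (prefix-value k)) (2 ^ d) ⟩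
    suc (prefix-value k) * (2 * 2 ^ d)                ∎
    where
    open ≤-Reasoning
    open +-*-Solver

  value-compare : ∀ k l → prefix-value k * 2 ^ l ≤ suc (prefix-value l) * 2 ^ k
  value-compare k l with ≤-total k l
  ... | inj₁ k≤l = begin
    prefix-value k * 2 ^ l                      ≡⟨ cong (λ j → prefix-value k * 2 ^ j) (m∸n+n≡m k≤l) ⟨
    prefix-value k * 2 ^ (l ∸ k + k)            ≡⟨ cong (prefix-value k *_) (^-distribˡ-+-* 2 (l ∸ k) k) ⟩
    prefix-value k * (2 ^ (l ∸ k) * 2 ^ k)      ≡⟨ *-assoc (prefix-value k) (2 ^ (l ∸ k)) (2 ^ k) ⟨
    prefix-value k * 2 ^ (l ∸ k) * 2 ^ k        ≤⟨ *-monoˡ-≤ (2 ^ k) (value-lower k (l ∸ k)) ⟩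
    prefix-value (l ∸ k + k) * 2 ^ k            ≡⟨ cong (λ j → prefix-value j * 2 ^ k) (m∸n+n≡m k≤l) ⟩
    prefix-value l * 2 ^ k                      ≤⟨ *-monoˡ-≤ (2 ^ k) (n≤1+n (prefix-value l)) ⟩
    suc (prefix-value l) * 2 ^ k                ∎
    where open ≤-Reasoning
  ... | inj₂ l≤k = begin
    prefix-value k * 2 ^ l                            ≡⟨ cong (λ j → prefix-value j * 2 ^ l) (m∸n+n≡m l≤k) ⟨
    prefix-value (k ∸ l + l) * 2 ^ l                  ≤⟨ *-monoˡ-≤ (2 ^ l) (≤-trans (n≤1+n _) (value-upper l (k ∸ l))) ⟩
    suc (prefix-value l) * 2 ^ (k ∸ l) * 2 ^ l        ≡⟨ *-assoc (suc (prefix-value l)) (2 ^ (k ∸ l)) (2 ^ l) ⟩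
    suc (prefix-value l) * (2 ^ (k ∸ l) * 2 ^ l)      ≡⟨ cong (suc (prefix-value l) *_) (^-distribˡ-+-* 2 (k ∸ l) l) ⟨
    suc (prefix-value l) * 2 ^ (k ∸ l + l)            ≡⟨ cong (λ j → suc (prefix-value l) * 2 ^ j) (m∸n+n≡m l≤k) ⟩
    suc (prefix-value l) * 2 ^ k                      ∎
    where open ≤-Reasoning

_/2^_ : ℕ → ℕ → ℚ
a /2^ k = ℚ._/_ (+ a) (2 ^ k) {{m^n≢0 2 k}}

/2^-scaled : ∀ a k → (a /2^ k) ℚ.* ι (2 ^ k) ≡ ι a
/2^-scaled a k = /-*-cancel a (2 ^ k) {{m^n≢0 2 k}}

/2^-cancel-≤ : ∀ {p q} k → p ℚ.* ι (2 ^ k) ℚ.≤ q ℚ.* ι (2 ^ k) → p ℚ.≤ q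
/2^-cancel-≤ k = /-cancel-≤ (2 ^ k) {{m^n≢0 2 k}}

0≤/2^ : ∀ a k → 0ℚ ℚ.≤ a /2^ k
0≤/2^ a k = /2^-cancel-≤ k (begin
  0ℚ ℚ.* ι (2 ^ k)         ≡⟨ ℚ.*-zeroˡ (ι (2 ^ k)) ⟩
  ι 0                      ≤⟨ ι-mono-≤ {0} {a} z≤n ⟩
  ι a                      ≡⟨ /2^-scaled a k ⟨
  (a /2^ k) ℚ.* ι (2 ^ k)  ∎)
  where open ℚ.≤-Reasoning

partial-upper : ∀ c k l → partial c k ℚ.≤ suc (prefix-value c l) /2^ l
partial-upper c k l = /2^-cancel-≤ k (/2^-cancel-≤ l (begin
  partial c k ℚ.* ι (2 ^ k) ℚ.* ι (2 ^ l)                ≡⟨ cong (ℚ._* ι (2 ^ l)) (partial-scaled c k) ⟩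
  ι (prefix-value c k) ℚ.* ι (2 ^ l)                     ≡⟨ ι-* (prefix-value c k) (2 ^ l) ⟨
  ι (prefix-value c k * 2 ^ l)                           ≤⟨ ι-mono-≤ (value-compare c k l) ⟩
  ι (suc (prefix-value c l) * 2 ^ k)                     ≡⟨ ι-* (suc (prefix-value c l)) (2 ^ k) ⟩
  ι (suc (prefix-value c l)) ℚ.* ι (2 ^ k)               ≡⟨ cong (ℚ._* ι (2 ^ k)) (/2^-scaled (suc (prefix-value c l)) l) ⟨
  (suc (prefix-value c l) /2^ l) ℚ.* ι (2 ^ l) ℚ.* ι (2 ^ k)  ≡⟨ xy∙z≈xz∙y (suc (prefix-value c l) /2^ l) (ι (2 ^ l)) (ι (2 ^ k)) ⟩
  (suc (prefix-value c l) /2^ l) ℚ.* ι (2 ^ k) ℚ.* ι (2 ^ l)  ∎))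
  where open ℚ.≤-Reasoning

-- The factors are r and q/r. The gap between q and r puts q/r below 1, and the gap between p and q
-- leaves p strictly below the product.
*ᴿ-unit : ∀ {a b : Real} {p q r} → rat 1ℚ ⊆ b → 0ℚ ℚ.≤ p → p ℚ.< q → q ℚ.< r → r ∈ a → p ∈ (a *ᴿ b)
*ᴿ-unit {p = p} {q} {r} 1⊆b 0≤p p<q q<r r∈a =
  inj₂ (r , q ℚ.* r⁻¹ , r∈a , 1⊆b s<1 , ℚ.<⇒≤ 0<r , 0≤s , subst (p ℚ.<_) (sym rs≡q) p<q)
  where
  0<q = ℚ.≤-<-trans 0≤p p<q
  0<r = ℚ.<-trans 0<q q<r
  instance
    r>0 : ℚ.Positive r
    r>0 = ℚ.positive 0<r
    r≢0 : ℚ.NonZero r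
    r≢0 = ℚ.pos⇒nonZero r
  r⁻¹ : ℚ
  r⁻¹ = ℚ.1/ r
  instance
    r⁻¹>0 : ℚ.Positive r⁻¹
    r⁻¹>0 = ℚ.1/pos⇒pos r
  s<1 : q ℚ.* r⁻¹ ℚ.< 1ℚ
  s<1 = subst (q ℚ.* r⁻¹ ℚ.<_) (ℚ.*-inverseʳ r) (ℚ.*-monoˡ-<-pos r⁻¹ q<r)
  0≤s : 0ℚ ℚ.≤ q ℚ.* r⁻¹
  0≤s = subst (ℚ._≤ q ℚ.* r⁻¹) (ℚ.*-zeroˡ r⁻¹) (ℚ.<⇒≤ (ℚ.*-monoˡ-<-pos r⁻¹ 0<q))
  rs≡q : r ℚ.* (q ℚ.* r⁻¹) ≡ q
  rs≡q = begin
    r ℚ.* (q ℚ.* r⁻¹)  ≡⟨ ℚ.*-comm r (q ℚ.* r⁻¹) ⟩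
    q ℚ.* r⁻¹ ℚ.* r    ≡⟨ ℚ.*-assoc q r⁻¹ r ⟩
    q ℚ.* (r⁻¹ ℚ.* r)  ≡⟨ cong (q ℚ.*_) (ℚ.*-inverseˡ r) ⟩
    q ℚ.* 1ℚ           ≡⟨ ℚ.*-identityʳ q ⟩
    q                  ∎
    where open ≡-Reasoning

-- Additivity turns the two upper bounds into a₀ = N₀ / 2^m.  Hence
-- N₀ 2^d − 1 ≤ prefix-value c (d + m) ≤ N₀ 2^d for all d, which leaves only the
-- two binary expansions of a dyadic number.
module _ {u a₀ a₁ : Real} {c : Seq 2} {m N₀ N₁ : ℕ}
  (u≐1 : u ≐ rat 1ℚ) (additive : u ≐ (a₀ +ᴿ a₁)) (a₀≐c : a₀ ≐ (binary c *ᴿ u))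
  (a₀≤ : a₀ ⊆ rat (N₀ /2^ m)) (a₁≤ : a₁ ⊆ rat (N₁ /2^ m)) (N₀+N₁≤ : N₀ + N₁ ≤ 2 ^ m)
  where

  private
    -- Otherwise N₀/2^m would itself lie in the cut `a₀`, whose members are all strictly below it.
    -- Density supplies the two gaps that `*ᴿ-unit` asks for.
    partial-bound : ∀ k → partial c k ℚ.≤ N₀ /2^ m
    partial-bound k = ℚ.≮⇒≥ λ N₀<S →
      let r , N₀<r , r<S = ℚ.<-dense N₀<S
          q , N₀<q , q<r = ℚ.<-dense N₀<r
      in ℚ.<-irrefl refl (a₀≤ (proj₂ a₀≐c (*ᴿ-unit (proj₂ u≐1) (0≤/2^ N₀ m) N₀<q q<r (k , r<S))))

    rescale : ∀ N d → (N /2^ m) ℚ.* ι (2 ^ (d + m)) ≡ ι (N * 2 ^ d)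
    rescale N d = begin
      (N /2^ m) ℚ.* ι (2 ^ (d + m))                  ≡⟨ cong (λ k → (N /2^ m) ℚ.* ι (2 ^ k)) (+-comm d m) ⟩
      (N /2^ m) ℚ.* ι (2 ^ (m + d))                  ≡⟨ cong (λ k → (N /2^ m) ℚ.* ι k) (^-distribˡ-+-* 2 m d) ⟩
      (N /2^ m) ℚ.* ι (2 ^ m * 2 ^ d)                ≡⟨ cong ((N /2^ m) ℚ.*_) (ι-* (2 ^ m) (2 ^ d)) ⟩
      (N /2^ m) ℚ.* (ι (2 ^ m) ℚ.* ι (2 ^ d))        ≡⟨ ℚ.*-assoc (N /2^ m) (ι (2 ^ m)) (ι (2 ^ d)) ⟨
      (N /2^ m) ℚ.* ι (2 ^ m) ℚ.* ι (2 ^ d)          ≡⟨ cong (ℚ._* ι (2 ^ d)) (/2^-scaled N m) ⟩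
      ι N ℚ.* ι (2 ^ d)                              ≡⟨ ι-* N (2 ^ d) ⟨
      ι (N * 2 ^ d)                                  ∎
      where open ≡-Reasoning

    value-≤ : ∀ d → prefix-value c (d + m) ≤ N₀ * 2 ^ d
    value-≤ d = ι-cancel-≤ (begin
      ι (prefix-value c (d + m))                     ≡⟨ partial-scaled c (d + m) ⟨
      partial c (d + m) ℚ.* ι (2 ^ (d + m))          ≤⟨ *ι-mono-≤ (2 ^ (d + m)) (partial-bound (d + m)) ⟩
      (N₀ /2^ m) ℚ.* ι (2 ^ (d + m))                 ≡⟨ rescale N₀ d ⟩
      ι (N₀ * 2 ^ d)                                 ∎)
      where open ℚ.≤-Reasoning

    a₀-upper : ∀ k {r} → r ∈ a₀ → r ℚ.≤ suc (prefix-value c k) /2^ k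
    a₀-upper k {r} r∈a₀ with proj₁ a₀≐c r∈a₀
    ... | inj₁ r<0 = ℚ.≤-trans (ℚ.<⇒≤ r<0) (0≤/2^ (suc (prefix-value c k)) k)
    ... | inj₂ (s , t , (l , s<S) , t∈u , 0≤s , _ , r<st) = begin
      r                               ≤⟨ ℚ.<⇒≤ r<st ⟩
      s ℚ.* t                         ≤⟨ ℚ.*-monoˡ-≤-nonNeg s {{ℚ.nonNegative 0≤s}} (ℚ.<⇒≤ (proj₁ u≐1 t∈u)) ⟩
      s ℚ.* 1ℚ                        ≡⟨ ℚ.*-identityʳ s ⟩
      s                               ≤⟨ ℚ.<⇒≤ s<S ⟩
      partial c l                     ≤⟨ partial-upper c l k ⟩
      suc (prefix-value c k) /2^ k    ∎
      where open ℚ.≤-Reasoning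

    -- Were the right-hand side below 1, it would lie in the cut `u`, and additivity would place it
    -- strictly below a sum of members of `a₀` and `a₁`, which the upper bounds forbid.
    total-mass : ∀ k → 1ℚ ℚ.≤ (suc (prefix-value c k) /2^ k) ℚ.+ (N₁ /2^ m)
    total-mass k = ℚ.≮⇒≥ λ q<1 →
      let _ , _ , r∈a₀ , s∈a₁ , q<r+s = proj₁ additive (proj₂ u≐1 q<1)
      in ℚ.<-asym q<r+s (ℚ.+-mono-≤-< (a₀-upper k r∈a₀) (a₁≤ s∈a₁))

    -- The second half takes at most N₁/2^m of the total mass, which leaves at least N₀/2^m for the
    -- first.
    value-≥ : ∀ d → N₀ * 2 ^ d ≤ suc (prefix-value c (d + m))
    value-≥ d = +-cancelʳ-≤ (N₁ * 2 ^ d) _ _ (begin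
      N₀ * 2 ^ d + N₁ * 2 ^ d      ≡⟨ *-distribʳ-+ (2 ^ d) N₀ N₁ ⟨
      (N₀ + N₁) * 2 ^ d            ≤⟨ *-monoˡ-≤ (2 ^ d) N₀+N₁≤ ⟩
      2 ^ m * 2 ^ d                ≡⟨ ^-distribˡ-+-* 2 m d ⟨
      2 ^ (m + d)                  ≡⟨ cong (2 ^_) (+-comm m d) ⟩
      2 ^ (d + m)                  ≤⟨ ι-cancel-≤ mass ⟩
      suc v + N₁ * 2 ^ d           ∎)
      where
      v = prefix-value c (d + m)
      mass : ι (2 ^ (d + m)) ℚ.≤ ι (suc v + N₁ * 2 ^ d)
      mass = begin
        ι (2 ^ (d + m))                                                ≡⟨ ℚ.*-identityˡ (ι (2 ^ (d + m))) ⟨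
        1ℚ ℚ.* ι (2 ^ (d + m))                                         ≤⟨ *ι-mono-≤ (2 ^ (d + m)) (total-mass (d + m)) ⟩
        ((suc v /2^ (d + m)) ℚ.+ (N₁ /2^ m)) ℚ.* ι (2 ^ (d + m))       ≡⟨ ℚ.*-distribʳ-+ (ι (2 ^ (d + m))) (suc v /2^ (d + m)) (N₁ /2^ m) ⟩
        (suc v /2^ (d + m)) ℚ.* ι (2 ^ (d + m)) ℚ.+ (N₁ /2^ m) ℚ.* ι (2 ^ (d + m))
                                                                       ≡⟨ cong₂ ℚ._+_ (/2^-scaled (suc v) (d + m)) (rescale N₁ d) ⟩
        ι (suc v) ℚ.+ ι (N₁ * 2 ^ d)                                   ≡⟨ ι-+ (suc v) (N₁ * 2 ^ d) ⟨
        ι (suc v + N₁ * 2 ^ d)                                         ∎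
        where open ℚ.≤-Reasoning
      open ≤-Reasoning

    double-power : ∀ N d → 2 * (N * 2 ^ d) ≡ N * 2 ^ suc d
    double-power N d = solve 2 (λ N p → con 2 :* (N :* p) := N :* (con 2 :* p)) refl N (2 ^ d)
      where open +-*-Solver

    -- With digit 0 at m, the lower bound at d = 1 reads 2·N₀ ≤ 2v + 1 for v = `prefix-value c m`,
    -- so N₀ ≤ v by parity. Then v already exhausts the upper bound, and no later digit can be 1:
    -- this is the terminating expansion.
    zero-stays : c m ≡ 0F → ∀ d → toℕ (c (d + m)) ≤ 0
    zero-stays cm≡0 d = +-cancelˡ-≤ (2 * prefix-value c (d + m)) _ _ (begin
      prefix-value c (suc d + m)            ≤⟨ value-≤ (suc d) ⟩
      N₀ * 2 ^ suc d                        ≡⟨ double-power N₀ d ⟨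
      2 * (N₀ * 2 ^ d)                      ≤⟨ *-monoʳ-≤ 2 (*-monoˡ-≤ (2 ^ d) N₀≤v) ⟩
      2 * (prefix-value c m * 2 ^ d)        ≤⟨ *-monoʳ-≤ 2 (value-lower c m d) ⟩
      2 * prefix-value c (d + m)            ≡⟨ +-identityʳ _ ⟨
      2 * prefix-value c (d + m) + 0        ∎)
      where
      open ≤-Reasoning
      N₀≤v : N₀ ≤ prefix-value c m
      N₀≤v = s≤s⁻¹ (*-cancelˡ-< 2 N₀ (suc (prefix-value c m)) (begin-strict
        2 * N₀                                    ≡⟨ *-comm 2 N₀ ⟩
        N₀ * 2 ^ 1                                ≤⟨ value-≥ 1 ⟩
        suc (2 * prefix-value c m + toℕ (c m))    ≡⟨ cong (λ b → suc (2 * prefix-value c m + toℕ b)) cm≡0 ⟩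
        suc (2 * prefix-value c m + 0)            ≡⟨ cong suc (+-identityʳ _) ⟩
        suc (2 * prefix-value c m)                <⟨ ≤-refl ⟩
        2 + 2 * prefix-value c m                  ≡⟨ *-suc 2 (prefix-value c m) ⟨
        2 * suc (prefix-value c m)                ∎))

    -- Dually, the upper bound at d = 1 gives v < N₀, and only digits 1 throughout can keep up with
    -- the lower bound.
    one-stays : c m ≡ 1F → ∀ d → 1 ≤ toℕ (c (d + m))
    one-stays cm≡1 d = +-cancelˡ-≤ (suc (2 * prefix-value c (d + m))) _ _ (begin
      suc (2 * prefix-value c (d + m)) + 1                ≡⟨ +-comm (suc (2 * prefix-value c (d + m))) 1 ⟩
      2 + 2 * prefix-value c (d + m)                      ≡⟨ *-suc 2 (prefix-value c (d + m)) ⟨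
      2 * suc (prefix-value c (d + m))                    ≤⟨ *-monoʳ-≤ 2 (value-upper c m d) ⟩
      2 * (suc (prefix-value c m) * 2 ^ d)                ≤⟨ *-monoʳ-≤ 2 (*-monoˡ-≤ (2 ^ d) v<N₀) ⟩
      2 * (N₀ * 2 ^ d)                                    ≡⟨ double-power N₀ d ⟩
      N₀ * 2 ^ suc d                                      ≤⟨ value-≥ (suc d) ⟩
      suc (2 * prefix-value c (d + m)) + toℕ (c (d + m))  ∎)
      where
      open ≤-Reasoning
      v<N₀ : prefix-value c m < N₀
      v<N₀ = *-cancelˡ-< 2 (prefix-value c m) N₀ (begin-strict
        2 * prefix-value c m                <⟨ ≤-reflexive (+-comm 1 _) ⟩
        2 * prefix-value c m + 1            ≡⟨ cong (λ b → 2 * prefix-value c m + toℕ b) cm≡1 ⟨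
        prefix-value c (1 + m)              ≤⟨ value-≤ 1 ⟩
        N₀ * 2 ^ 1                          ≡⟨ *-comm N₀ 2 ⟩
        2 * N₀                              ∎)

  digits-stabilise : ∀ d → c (d + m) ≡ c m
  digits-stabilise d with c m in cm≡ | c (d + m) in cd≡
  ... | 0F | 0F = refl
  ... | 1F | 1F = refl
  ... | 0F | 1F = contradiction (subst (λ b → toℕ b ≤ 0) cd≡ (zero-stays cm≡ d)) λ ()
  ... | 1F | 0F = contradiction (subst (λ b → 1 ≤ toℕ b) cd≡ (one-stays cm≡ d)) λ ()

-- Two tests

∸-suc : ∀ {m j} → j < m → m ∸ j ≡ suc (m ∸ suc j)
∸-suc {suc m} (s≤s j≤m) = +-∸-assoc 1 j≤m

module _ (P : ComputablePairing) where
  open ComputablePairing P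

  -- One family of i positions suffices, with m and b built into the test as constants. Column 0
  -- belongs to the root, whose index is 0, and so governs the mass of ⟦0⟧.
  column-not-eventually-constant : ∀ {z} → MLRandom z → ∀ m b → ¬ (∀ d → column P z 0 (d + m) ≡ b)
  column-not-eventually-constant random m b constant =
    random-escapes {b = b} {b′ = other b} (other-≢ b) {T = λ _ → 1} {len = λ i → i} {pos = λ _ _ j → ⟨ 0 , j + m ⟩}
      (computable₁ (const-computable 1))
      (computable₁ (var 0F))
      (computable₃ (lift₂ {F = λ a b → ⟨ a , b ⟩} computable (const-computable 0) (lift₂ +-computable (var 2F) (const-computable m))))
      (λ i _ _ _ eq → +-cancelʳ-≡ m _ _ (cong proj₂ (proj₁ bijective eq)))
      (λ i → ≤-reflexive (*-identityˡ (2 ^ i)))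
      random (λ i → 0 , s≤s z≤n , λ j _ → constant j)
    where
    other : Fin 2 → Fin 2
    other 0F = 1F
    other 1F = 0F
    other-≢ : ∀ b → other b ≢ b
    other-≢ 0F ()
    other-≢ 1F ()

-- Paths of the binary tree with all labels 2

module BinaryTree where
  open Codes 2

  parent-level : ∀ m {c} → 2 ^ suc m ≤ suc c → 2 ^ m ≤ suc (parent c)
  parent-level m {c} le = s≤s⁻¹ (*-cancelˡ-< 2 (2 ^ m) (suc (suc (parent c))) (begin-strict
    2 * 2 ^ m                    ≤⟨ le ⟩
    suc c                        ≤⟨ s≤s (parent-bound c) ⟩
    suc (2 * suc (parent c))     <⟨ ≤-refl ⟩
    2 + 2 * suc (parent c)       ≡⟨ *-suc 2 (suc (parent c)) ⟨
    2 * suc (suc (parent c))     ∎))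
    where open ≤-Reasoning

  -- A node has level at least m iff 2^m ≤ c + 1. Keeping to ancestors below the root matters
  -- because the root has no label and `pred` would confuse it with node 1.
  ancestor-nonzero : ∀ j m {c} → 2 ^ m ≤ suc c → j < m → 0 < ancestor j c
  ancestor-nonzero j m {c} le j<m =
    s≤s⁻¹ (≤-trans (^-monoʳ-≤ 2 (m<n⇒0<n∸m j<m)) (level j (<⇒≤ j<m)))
    where
    level : ∀ j → j ≤ m → 2 ^ (m ∸ j) ≤ suc (ancestor j c)
    level zero    _   = le
    level (suc j) j<m = parent-level (m ∸ suc j) (subst (λ k → 2 ^ k ≤ suc (ancestor j c)) (∸-suc j<m) (level j (<⇒≤ j<m)))

  ancestor-decreasing : ∀ {j k c} → 0 < ancestor j c → j < k → ancestor k c < ancestor j c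
  ancestor-decreasing {j} {k} {c} 0<a j<k = begin-strict
    ancestor k c                          ≡⟨ cong (λ k → ancestor k c) (m∸n+n≡m (<⇒≤ j<k)) ⟨
    ancestor (k ∸ j + j) c                ≡⟨ fold-+ c parent (k ∸ j) ⟩
    ancestor (k ∸ j) (ancestor j c)       ≤⟨ ancestor≤∸ (k ∸ j) (ancestor j c) ⟩
    ancestor j c ∸ (k ∸ j)                ≤⟨ ∸-monoʳ-≤ (ancestor j c) (m<n⇒0<n∸m j<k) ⟩
    ancestor j c ∸ 1                      <⟨ ∸-monoʳ-< {ancestor j c} (s≤s z≤n) 0<a ⟩
    ancestor j c                          ∎
    where open ≤-Reasoning

  index-lower : ∀ (y : Seq 2) m → 2 ^ m ≤ suc (index (y ↾ m))
  index-lower y zero    = ≤-refl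
  index-lower y (suc m) = begin
    2 * 2 ^ m                                   ≤⟨ *-monoʳ-≤ 2 (index-lower y m) ⟩
    2 * suc (index (y ↾ m))                     ≡⟨ *-suc 2 (index (y ↾ m)) ⟩
    2 + 2 * index (y ↾ m)                       ≡⟨ cong suc (+-comm 1 (2 * index (y ↾ m))) ⟩
    suc (2 * index (y ↾ m) + 1)                 ≤⟨ s≤s (+-monoʳ-≤ (2 * index (y ↾ m)) (s≤s z≤n)) ⟩
    suc (2 * index (y ↾ m) + suc (toℕ (y m)))   ≡⟨ cong suc (index-suc y m) ⟨
    suc (index (y ↾ suc m))                     ∎
    where open ≤-Reasoning

  index-upper : ∀ (y : Seq 2) m → suc (index (y ↾ m)) < 2 ^ m + 2 ^ m
  index-upper y zero    = ≤-refl
  index-upper y (suc m) = begin-strict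
    suc (index (y ↾ suc m))                     ≡⟨ cong suc (index-suc y m) ⟩
    suc (2 * index (y ↾ m) + suc (toℕ (y m)))   ≤⟨ s≤s (+-monoʳ-≤ (2 * index (y ↾ m)) (toℕ<n (y m))) ⟩
    suc (2 * index (y ↾ m) + 2)                 <⟨ ≤-refl ⟩
    2 + (2 * index (y ↾ m) + 2)                 ≡⟨ cong (λ k → 2 + k) (+-comm (2 * index (y ↾ m)) 2) ⟩
    2 + (2 + 2 * index (y ↾ m))                 ≡⟨ cong (λ k → 2 + k) (*-suc 2 (index (y ↾ m))) ⟨
    2 + 2 * suc (index (y ↾ m))                 ≡⟨ *-suc 2 (suc (index (y ↾ m))) ⟨
    2 * suc (suc (index (y ↾ m)))               ≤⟨ *-monoʳ-≤ 2 (index-upper y m) ⟩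
    2 * (2 ^ m + 2 ^ m)                         ≡⟨ *-distribˡ-+ 2 (2 ^ m) (2 ^ m) ⟩
    2 ^ suc m + 2 ^ suc m                       ∎
    where open ≤-Reasoning

  private
    -- Nodes are coded by their index; those of level m start at 2^m − 1.
    node : ℕ → ℕ → ℕ
    node m t = pred (2 ^ m) + t

    node-level : ∀ m t → 2 ^ m ≤ suc (node m t)
    node-level m t = begin
      2 ^ m                    ≡⟨ suc-pred (2 ^ m) {{m^n≢0 2 m}} ⟨
      suc (pred (2 ^ m))       ≤⟨ s≤s (m≤m+n (pred (2 ^ m)) t) ⟩
      suc (node m t)           ∎
      where open ≤-Reasoning

  module _ (x : Seq 3) where

    -- The path is read upwards from its leaf, since ancestors are computable from the code of the
    -- leaf alone; j < m stops short of the root.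
    Constant : ℕ → ℕ → Set
    Constant m t = ∀ j → j < m → x (pred (ancestor j (node m t))) ≡ 2F

    -- The expected number of paths of length 2i all labelled 2 is (4/9)^i.
    random-no-constant-paths : MLRandom x → ¬ (∀ i → ∃[ t ] t < 2 ^ (2 * i) × Constant (2 * i) t)
    random-no-constant-paths = random-escapes {b = 2F} {b′ = 0F} (λ ())
      {T = λ i → 2 ^ (2 * i)} {len = 2 *_} {pos = λ i t j → pred (ancestor j (node (2 * i) t))}
      (computable₁ leaves) double
      (computable₃ (lift₁ pred-computable (lift₂ ancestor-computable (var 2F)
        (lift₂ +-computable (lift₁ pred-computable leaves) (var 1F)))))
      (λ i {t} _ j<l k<l eq → injective (2 * i) t j<l k<l eq)
      -- Paths of length i would give only (2/3)^i, which is above 2^(-i) for i > 0. Doubling the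
      -- length reduces the claim to 8 ≤ 9.
      (λ i → begin
        2 ^ (2 * i) * 2 ^ i      ≡⟨ ^-distribˡ-+-* 2 (2 * i) i ⟨
        2 ^ (2 * i + i)          ≡⟨ cong (2 ^_) (+-comm (2 * i) i) ⟩
        2 ^ (3 * i)              ≡⟨ ^-*-assoc 2 3 i ⟨
        8 ^ i                    ≤⟨ ^-monoˡ-≤ i (n≤1+n 8) ⟩
        9 ^ i                    ≡⟨ ^-*-assoc 3 2 i ⟩
        3 ^ (2 * i)              ∎)
      where
      open ≤-Reasoning
      double : Computable₁ (2 *_)
      double = computable₁ (lift₂ *-computable (const-computable 2) (var 0F))
      leaves : ∀ {n} → Computable {suc n} (λ as → 2 ^ (2 * lookup as 0F))
      leaves = lift₁ (^-computable 2) (lift₁ double (var 0F))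
      distinct : ∀ m t {j k} → j < m → k < m → j < k → pred (ancestor j (node m t)) ≢ pred (ancestor k (node m t))
      distinct m t {j} {k} j<m k<m j<k eq =
        <⇒≢ (pred-mono-< {{>-nonZero (ancestor-nonzero k m (node-level m t) k<m)}}
              (ancestor-decreasing {c = node m t} (ancestor-nonzero j m (node-level m t) j<m) j<k)) (sym eq)
      injective : ∀ m t {j k} → j < m → k < m → pred (ancestor j (node m t)) ≡ pred (ancestor k (node m t)) → j ≡ k
      injective m t {j} {k} j<m k<m eq with <-cmp j k
      ... | tri≈ _ j≡k _ = j≡k
      ... | tri< j<k _ _ = contradiction eq (distinct m t j<m k<m j<k)
      ... | tri> _ _ k<j = contradiction (sym eq) (distinct m t k<m j<m k<j)

    constant-labels : ∀ m (y : Seq 2) → (∀ k → k < m → labels x y k ≡ 2F) → ∃[ t ] t < 2 ^ m × Constant m t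
    constant-labels m y all-2 = t , t<2^m , λ j j<m → begin
      x (pred (ancestor j (pred (2 ^ m) + t)))     ≡⟨ cong (λ c → x (pred (ancestor j c))) (m+[n∸m]≡n pred≤c) ⟩
      x (pred (ancestor j c))                      ≡⟨ cong (λ c → x (pred c)) (ancestor-index y j m) ⟩
      x (pred (index (y ↾ (m ∸ j))))               ≡⟨ cong (λ k → x (pred (index (y ↾ k)))) (∸-suc j<m) ⟩
      labels x y (m ∸ suc j)                       ≡⟨ all-2 (m ∸ suc j) (≤-trans (≤-reflexive (sym (∸-suc j<m))) (m∸n≤m m j)) ⟩
      2F                                           ∎
      where
      open ≡-Reasoning
      c = index (y ↾ m)
      t = c ∸ pred (2 ^ m)
      pred≤c : pred (2 ^ m) ≤ c
      pred≤c = pred-mono-≤ (index-lower y m)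
      t<2^m : t < 2 ^ m
      t<2^m = +-cancelˡ-< (2 ^ m) t (2 ^ m) (subst (_< 2 ^ m + 2 ^ m) eq (index-upper y m))
        where
        eq : suc c ≡ 2 ^ m + t
        eq = trans (cong suc (sym (m+[n∸m]≡n pred≤c))) (cong (_+ t) (suc-pred (2 ^ m) {{m^n≢0 2 m}}))

    constant? : ∀ m → Dec (∃[ t ] t < 2 ^ m × Constant m t)
    constant? m = anyUpTo? (λ t → map′ (λ p j → p {j}) (λ p {j} → p j)
      (allUpTo? (λ j → x (pred (ancestor j (node m t))) ≟ᶠ 2F) m)) (2 ^ m)

-- The first output bit

module _ {n : ℕ} where

  -- n^m times the conditional expectation, given ⟦σ⟧, of h (y ↾ m).
  expectation : ℕ → (Str n → ℕ) → Str n → ℕ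
  expectation zero    h σ       = h []
  expectation (suc m) h []      = ∑ (λ a → expectation m (h ∘ (a ∷_)) [])
  expectation (suc m) h (a ∷ σ) = n * expectation m (h ∘ (a ∷_)) σ

  -- The tower property of conditional expectations; the normalisation n^m is the same for all
  -- lengths of σ.
  supermartingale-expectation : ∀ m h → Supermartingale (expectation m h)
  supermartingale-expectation zero    h σ       = ≤-reflexive (∑-const n (h []))
  supermartingale-expectation (suc m) h []      =
    ≤-reflexive (sym (*-distribˡ-sum n (λ a → expectation m (h ∘ (a ∷_)) [])))
  supermartingale-expectation (suc m) h (c ∷ σ) =
    ≤-trans (≤-reflexive (sym (*-distribˡ-sum n (λ a → expectation m (h ∘ (c ∷_)) (σ ∷ʳ a)))))
      (*-monoʳ-≤ n (supermartingale-expectation m (h ∘ (c ∷_)) σ))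

  cons : Fin n → Seq n → Seq n
  cons a y zero    = a
  cons a y (suc k) = y k

  -- The hypothesis speaks of infinite sequences, as inclusions of cylinders do. The letter provides
  -- a point of ⟦σ⟧ once all m letters have been used up.
  expectation-≥ : Fin n → ∀ m h σ → (∀ y → y ∈ ⟦ σ ⟧ → 1 ≤ h (y ↾ m)) → n ^ m ≤ expectation m h σ
  expectation-≥ a zero    h σ       h≥1 = h≥1 (pad a σ) (pad-∈ a σ)
  expectation-≥ a (suc m) h []      h≥1 = ≤-trans (≤-reflexive (sym (∑-const n (n ^ m))))
    (∑-mono-≤ λ b → expectation-≥ a m (h ∘ (b ∷_)) [] (λ y _ → h≥1 (cons b y) refl))
  expectation-≥ a (suc m) h (b ∷ σ) h≥1 =
    *-monoʳ-≤ n (expectation-≥ a m (h ∘ (b ∷_)) σ (λ y y∈σ → h≥1 (cons b y) (cong (b ∷_) y∈σ)))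

  expectation-+ : ∀ m g h → (∀ σ → g σ + h σ ≤ 1) → expectation m g [] + expectation m h [] ≤ n ^ m
  expectation-+ zero    g h g+h≤1 = g+h≤1 []
  expectation-+ (suc m) g h g+h≤1 = begin
    ∑ (λ a → expectation m (g ∘ (a ∷_)) []) + ∑ (λ a → expectation m (h ∘ (a ∷_)) [])
      ≡⟨ ∑-distrib-+ (λ a → expectation m (g ∘ (a ∷_)) []) (λ a → expectation m (h ∘ (a ∷_)) []) ⟨
    ∑ (λ a → expectation m (g ∘ (a ∷_)) [] + expectation m (h ∘ (a ∷_)) [])
      ≤⟨ ∑-mono-≤ (λ a → expectation-+ m (g ∘ (a ∷_)) (h ∘ (a ∷_)) (g+h≤1 ∘ (a ∷_))) ⟩
    ∑ {n} (λ _ → n ^ m)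
      ≡⟨ ∑-const n (n ^ m) ⟩
    n ^ suc m ∎
    where open ≤-Reasoning

module _ (x : Seq 3) where

  -- Carries the code of the node reached, which is the accumulator of `index`, and so makes the
  -- labels along y a function of a finite string.
  labelsFrom : ℕ → Str 2 → Str 3
  labelsFrom c []      = []
  labelsFrom c (a ∷ τ) = let d = 2 * c + suc (toℕ a) in x (pred d) ∷ labelsFrom d τ

  labels-↾ : ∀ y m → labels x y ↾ m ≡ labelsFrom 0 (y ↾ m)
  labels-↾ y m = go 0 y m
    where
    go : ∀ c y m → applyUpTo (λ k → x (pred (foldl (λ c a → 2 * c + suc (toℕ a)) c (y ↾ suc k)))) m
                   ≡ labelsFrom c (y ↾ m)
    go c y zero    = refl
    go c y (suc m) = cong (_ ∷_) (go _ (y ∘ suc) m)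

  firstBit : Str 2 → Maybe (Fin 2)
  firstBit τ = head (mapMaybe bit (labelsFrom 0 τ))

indicator : Fin 2 → Maybe (Fin 2) → ℕ
indicator 0F (just 0F) = 1
indicator 1F (just 1F) = 1
indicator _  _         = 0

indicator-just : ∀ b → indicator b (just b) ≡ 1
indicator-just 0F = refl
indicator-just 1F = refl

indicator-≤ : ∀ u → indicator 0F u + indicator 1F u ≤ 1
indicator-≤ nothing   = z≤n
indicator-≤ (just 0F) = ≤-refl
indicator-≤ (just 1F) = ≤-refl

-- The first label other than 2 lies among the first m, and any prefix that yields output at all
-- yields the same first bit. Inspecting the labels one by one makes the negated hypothesis suffice.
head-bits : ∀ {b} (l : Seq 3) m m′ → ¬ (∀ k → k < m → l k ≡ 2F) →
  (b ∷ []) ≼ mapMaybe bit (l ↾ m′) → head (mapMaybe bit (l ↾ m)) ≡ just b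
head-bits l zero    m′       not-2 p = contradiction (λ _ ()) not-2
head-bits l (suc m) zero     not-2 ()
head-bits l (suc m) (suc m′) not-2 p with l 0 in l0≡
... | 0F with refl ∷ _ ← p = refl
... | 1F with refl ∷ _ ← p = refl
... | 2F = head-bits (l ∘ suc) m m′
  (λ all-2 → not-2 λ { zero _ → l0≡ ; (suc k) (s≤s k<m) → all-2 k k<m }) p

module _ (F : PartialMap) (x : Seq 3) (F≐x : ∀ y → F y ≐ function x y)
  (m : ℕ) (finite : ∀ y → ¬ (∀ k → k < m → labels x y k ≡ 2F)) where

  -- At the empty string the scaled expectation is a count: of the strings of length m along which
  -- the first output bit is b.
  hits : Fin 2 → ℕ
  hits b = expectation m (indicator b ∘ firstBit x) []

  hits-+ : hits 0F + hits 1F ≤ 2 ^ m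
  hits-+ = expectation-+ m (indicator 0F ∘ firstBit x) (indicator 1F ∘ firstBit x) (indicator-≤ ∘ firstBit x)

  -- On a cylinder inside the preimage every point is a hit by its first m letters, so the scaled
  -- expectation there is at least 2^m.
  induced-≤ : ∀ b → induced F (b ∷ []) ⊆ rat (hits b /2^ m)
  induced-≤ b = measure-bound (F ⁻¹⟦ b ∷ [] ⟧) (2 ^ m) {{m^n≢0 2 m}}
    (supermartingale-expectation m hit) λ σ σ⊆ → expectation-≥ 0F m hit σ λ y y∈σ →
      ≤-reflexive (sym (trans (cong (indicator b) (first y (σ⊆ y∈σ))) (indicator-just b)))
    where
    hit : Str 2 → ℕ
    hit = indicator b ∘ firstBit x
    first : ∀ y → (b ∷ []) ∈ F y → firstBit x (y ↾ m) ≡ just b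
    first y b∈Fy with _ , m′ , p ← proj₁ (F≐x y) b∈Fy =
      trans (cong (head ∘ mapMaybe bit) (sym (labels-↾ x y m))) (head-bits (labels x y) m m′ (finite y) p)

theorem6p13 : (P : ComputablePairing) (F : PartialMap) →
    RandomContinuousFunction F → ¬ RandomMeasure P (induced F)
theorem6p13 P F (x , x-random , F≐x) (z , z-random , probability , z-measure) =
  random-no-constant-paths x x-random λ i → decidable-stable (constant? x (2 * i)) (finite-depth (2 * i))
  where
  open BinaryTree
  open IsProbabilityMeasure probability
  finite-depth : ∀ m → ¬ ¬ (∃[ t ] t < 2 ^ m × Constant x m t)
  finite-depth m none = column-not-eventually-constant P z-random m (column P z 0 m)
    (digits-stabilise {c = column P z 0} {m = m} {hits F x F≐x m finite 0F} {hits F x F≐x m finite 1F}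
      total (additive []) (z-measure [])
      (induced-≤ F x F≐x m finite 0F) (induced-≤ F x F≐x m finite 1F) (hits-+ F x F≐x m finite))
    where
    finite : ∀ y → ¬ (∀ k → k < m → labels x y k ≡ 2F)
    finite y all-2 = none (constant-labels x m y all-2)
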